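{- Let $\mathsf{h}_1,\mathsf{h}_2$ be Hessenberg functions on $[n]$ and let $\mathsf{U}_{\mathsf{h}_1},\mathsf{U}_{\mathsf{h}_2}$ be the associated unipotent subgroups of $\mathrm{G}=\mathrm{GL}_n(\mathbb{F}_q)$. Then \[ |\mathsf{U}_{\mathsf{h}_1}\backslash\mathrm{G}/\mathsf{U}_{\mathsf{h}_2}|=q^{|\mathsf{h}_1|+|\mathsf{h}_2|-2n^2}\sum_{\mu\vdash n}|\mathrm{Z}_{\mathrm{G}}(I+J_\mu)|\,\mathrm{F}_{\mu\mathsf{h}_1}(q)\,\mathrm{F}_{\mu\mathsf{h}_2}(q), \] where $\mathrm{Z}_{\mathrm{G}}(I+J_\mu)$ is the centralizer of $I+J_\mu$ in $\mathrm{G}$.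
   Context: A Hessenberg function is a non-decreasing $\mathsf{h}:[n]\to[n]$ with $\mathsf{h}(i)\ge i$; $|\mathsf{h}|=\sum_i\mathsf{h}(i)$. $\mathfrak{u}_\mathsf{h}(\mathbb{F}_q)$ is the set of $n\times n$ matrices $(a_{ij})$ over $\mathbb{F}_q$ with $a_{ij}=0$ whenever $j\le\mathsf{h}(i)$, and $\mathsf{U}_\mathsf{h}=\{I+A:A\in\mathfrak{u}_\mathsf{h}(\mathbb{F}_q)\}$. $J_\mu$ is the nilpotent Jordan matrix of type $\mu$, $\mathcal{C}_\mu$ its $\mathrm{GL}_n(\mathbb{F}_q)$-conjugacy class, $\mathrm{F}_{\mu\mathsf{h}}(q)=|\mathcal{C}_\mu\cap\mathfrak{u}_\mathsf{h}(\mathbb{F}_q)|$. -}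

module Defs where

open import Data.Nat as ℕ using (ℕ; zero; suc; _∸_; _⊓_; _≤_)
open import Data.Bool using (Bool; true; false; _∧_; if_then_else_; not)
open import Data.Fin using (Fin; toℕ)
open import Data.Fin.Properties using () renaming (_≟_ to _≟ᶠ_)
open import Data.List using (List; []; _∷_; [_]; map; concatMap; length; allFin; upTo; foldr)
open import Data.Bool.ListAction using (all; any)
open import Data.List.Membership.Propositional using (_∈_)
open import Data.List.Relation.Unary.Unique.Propositional using (Unique)
open import Data.Product using (∃)
open import Data.Vec.Functional using () renaming (_∷_ to _∷ᶠ_)
open import Relation.Binary.PropositionalEquality using (_≡_; _≢_)
open import Relation.Binary.Definitions using (DecidableEquality)
open import Relation.Nullary.Decidable using (⌊_⌋)
open import Algebra.Structures using (IsCommutativeRing)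

record FiniteField : Set₁ where
  infixl 6 _+_
  infixl 7 _*_
  field
    Carrier : Set
    _+_ _*_ : Carrier → Carrier → Carrier
    -_ : Carrier → Carrier
    0# 1# : Carrier
    isCommutativeRing : IsCommutativeRing _≡_ _+_ _*_ -_ 0# 1#
    _≟_ : DecidableEquality Carrier
    0≢1 : 0# ≢ 1#
    inverse : ∀ x → x ≢ 0# → ∃ λ y → x * y ≡ 1#
    elements : List Carrier
    complete : ∀ x → x ∈ elements
    unique : Unique elements

  q : ℕ
  q = length elements

-- Hessenberg functions on [n] (encoded 0-based on Fin n:
-- h(i) in the paper corresponds to toℕ (fun i') + 1 for i = toℕ i' + 1)

record Hessenberg (n : ℕ) : Set where
  field
    fun : Fin n → Fin n
    mono : ∀ i j → toℕ i ≤ toℕ j → toℕ (fun i) ≤ toℕ (fun j)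
    extensive : ∀ i → toℕ i ≤ toℕ (fun i)

-- |h| = Σ_i h(i)   (1-based values)
size : ∀ {n} → Hessenberg n → ℕ
size {n} h = foldr ℕ._+_ 0 (map (λ i → suc (toℕ (Hessenberg.fun h i))) (allFin n))

-- Partitions of n: nonincreasing lists of positive integers summing to n.
-- partsF fuel m k : partitions of m with all parts ≤ k (fuel ≥ m suffices)

partsF : ℕ → ℕ → ℕ → List (List ℕ)
partsF _ zero _ = [ [] ]
partsF zero (suc _) _ = []
partsF (suc f) (suc m) k =
  concatMap (λ j → map (suc j ∷_) (partsF f (suc m ∸ suc j) (suc j)))
            (upTo (k ⊓ suc m))

partitions : ℕ → List (List ℕ)
partitions n = partsF n n n

count : {A : Set} → (A → Bool) → List A → ℕ
count p [] = 0
count p (x ∷ xs) = if p x then suc (count p xs) else count p xs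

filterᵇ : {A : Set} → (A → Bool) → List A → List A
filterᵇ p [] = []
filterᵇ p (x ∷ xs) = if p x then x ∷ filterᵇ p xs else filterᵇ p xs

classesAux : {A : Set} → (A → A → Bool) → List A → List A → ℕ
classesAux R seen [] = 0
classesAux R seen (x ∷ xs) =
  if any (λ s → R s x) seen then classesAux R seen xs
  else suc (classesAux R (x ∷ seen) xs)

numClasses : {A : Set} → (A → A → Bool) → List A → ℕ
numClasses R xs = classesAux R [] xs

module Matrices (𝔽 : FiniteField) (n : ℕ) where
  open FiniteField 𝔽

  Mat : Set
  Mat = Fin n → Fin n → Carrier

  allVecs : {A : Set} → List A → (k : ℕ) → List (Fin k → A)
  allVecs xs zero = [ (λ ()) ]
  allVecs xs (suc k) = concatMap (λ a → map (a ∷ᶠ_) (allVecs xs k)) xs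

  allMats : List Mat
  allMats = allVecs (allVecs elements n) n

  _==_ : Mat → Mat → Bool
  A == B = all (λ i → all (λ j → ⌊ A i j ≟ B i j ⌋) (allFin n)) (allFin n)

  _·_ : Mat → Mat → Mat
  (A · B) i j = foldr _+_ 0# (map (λ k → A i k * B k j) (allFin n))

  _⊕_ : Mat → Mat → Mat
  (A ⊕ B) i j = A i j + B i j

  I : Mat
  I i j = if ⌊ i ≟ᶠ j ⌋ then 1# else 0#

  isInvertible : Mat → Bool
  isInvertible A = any (λ B → (A · B) == I ∧ ((B · A) == I)) allMats

  GL : List Mat
  GL = filterᵇ isInvertible allMats

  inLieU : Hessenberg n → Mat → Bool
  inLieU h A = all (λ i → all (λ j →
      if ⌊ toℕ j ℕ.≤? toℕ (Hessenberg.fun h i) ⌋ then ⌊ A i j ≟ 0# ⌋ else true)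
    (allFin n)) (allFin n)

  lieU : Hessenberg n → List Mat
  lieU h = filterᵇ (inLieU h) allMats

  U : Hessenberg n → List Mat
  U h = map (I ⊕_) (lieU h)

  sameDoubleCoset : Hessenberg n → Hessenberg n → Mat → Mat → Bool
  sameDoubleCoset h₁ h₂ g g' =
    any (λ u₁ → any (λ u₂ → ((u₁ · g) · u₂) == g') (U h₂)) (U h₁)

  doubleCosets : Hessenberg n → Hessenberg n → ℕ
  doubleCosets h₁ h₂ = numClasses (sameDoubleCoset h₁ h₂) GL

  -- block ends of J_μ: partial sums of μ
  partialSums : List ℕ → ℕ → List ℕ
  partialSums [] acc = []
  partialSums (m ∷ μ) acc = (acc ℕ.+ m) ∷ partialSums μ (m ℕ.+ acc)

  -- nilpotent Jordan matrix J_μ (ones on the superdiagonal inside blocks)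
  J : List ℕ → Mat
  J μ i j =
    if ⌊ toℕ j ℕ.≟ suc (toℕ i) ⌋ ∧ not (any (λ s → ⌊ s ℕ.≟ suc (toℕ i) ⌋) (partialSums μ 0))
    then 1# else 0#

  inClass : List ℕ → Mat → Bool
  inClass μ A = any (λ g → any (λ g⁻¹ →
      ((g · g⁻¹) == I) ∧ ((g⁻¹ · g) == I) ∧ (A == ((g⁻¹ · J μ) · g))) allMats) allMats

  Fcount : List ℕ → Hessenberg n → ℕ
  Fcount μ h = count (inClass μ) (lieU h)

  centralizerSize : List ℕ → ℕ
  centralizerSize μ = count (λ g → (g · (I ⊕ J μ)) == ((I ⊕ J μ) · g)) GL

{-# OPTIONS --safe #-}

-- By Burnside's lemma for U₁ × U₂ acting on GL, the number of double cosets times |U₁||U₂| is the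
-- number of triples (u₁ , g , u₂) with u₁ g = g u₂, i.e. the sum over A ∈ 𝔲₁, B ∈ 𝔲₂ of the number of
-- g ∈ GL with A g = g B. That number is the order of the centralizer of J_μ when A and B are both of
-- Jordan type μ, and it is 0 when their types differ; so the formula follows as soon as every A ∈ 𝔲₁
-- has exactly one Jordan type. Existence is proved by adding one basis vector at a time to a sum of
-- blocks F[t]/(t^m); uniqueness because dim ker T^k = Σᵢ min(μᵢ , k) for all k determines μ.
module Submission where

open import Defs
open import Algebra.Bundles using (CommutativeRing; CommutativeSemigroup; Ring)
import Algebra.Properties.CommutativeSemigroup as CommutativeSemigroupProperties
import Algebra.Properties.Semiring.Sum as SemiringSum
open import Data.Bool using (Bool; true; false; _∧_; _∨_; if_then_else_; not)
open import Data.Bool.ListAction using (all; and; any)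
open import Data.Fin using (Fin; zero; suc; toℕ)
open import Data.Fin.Properties using (toℕ<n) renaming (_≟_ to _≟ᶠ_)
open import Data.List using (List; []; _∷_; map; concatMap; length; allFin; tabulate; foldr; upTo; applyUpTo)
import Data.List as List
open import Data.List.Properties using (map-tabulate; map-∘; tabulate-cong; length-tabulate; ≡-dec)
open import Data.List.Membership.Propositional using (_∈_)
open import Data.List.Relation.Unary.All using (All; []; _∷_)
import Data.List.Relation.Unary.All as All
import Data.List.Relation.Unary.All.Properties as All
open import Data.List.Relation.Unary.Any using (here; there)
open import Data.List.Relation.Unary.Unique.Propositional using (Unique; []; _∷_)
open import Data.Nat as ℕ using (ℕ; zero; suc; _+_; _*_; _∸_; _^_; _⊓_; _≤_; _<_; _<?_; z≤n; s≤s)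
open import Data.Nat.ListAction using (sum; product)
open import Data.Nat.Properties hiding (_≟_)
open import Data.Product using (∃; _×_; _,_; proj₁; proj₂)
open import Data.Sum using (_⊎_; inj₁; inj₂)
open import Data.Unit using (⊤; tt)
open import Data.Vec using (Vec; []; _∷_; _++_; _∷ʳ_; zipWith; replicate; lookup)
import Data.Vec as Vec
import Data.Vec.Properties as Vec
open import Data.Vec.Functional using () renaming (_∷_ to _∷ᶠ_)
open import Function using (_∘_; id; case_of_)
open import Relation.Binary using (tri<; tri≈; tri>)
open import Relation.Binary.PropositionalEquality hiding (J)
open import Relation.Nullary using (¬_; Dec; yes; no; Reflects; ofʸ; ofⁿ; contradiction; _×-reflects_)
open import Relation.Nullary.Decidable using (⌊_⌋; isYes≗does)

-- Counting over finite enumerations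

-- The obstacle that shapes the counting is that matrices are functions, compared only entry by
-- entry. Finite sets are therefore enumerated up to an equivalence, each class once; subsets enter
-- sums as 0/1 weights, and a bijection becomes a reindexing of weighted sums whose terms respect
-- the equivalence. The module theory uses inductive vectors instead, where equations are
-- propositional, and matrices enter it only through their action on row vectors. Since `h i ≥ i`,
-- every member of 𝔲_h is strictly upper triangular; this is what makes the induction on n behind
-- the Jordan form possible. For uniqueness, dimensions of kernels are replaced by their orders,
-- which are powers of q. The power of q in the formula has an exponent that is at most 0, so it is
-- moved to the side of the double cosets, where it is |U₁||U₂|.

∑ : {A : Set} → List A → (A → ℕ) → ℕ
∑ xs f = sum (map f xs)

𝟙 : Bool → ℕ
𝟙 b = if b then 1 else 0

module _ {A : Set} where
  open ≡-Reasoning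

  ∑-cong : (xs : List A) {f g : A → ℕ} → (∀ x → f x ≡ g x) → ∑ xs f ≡ ∑ xs g
  ∑-cong [] e = refl
  ∑-cong (x ∷ xs) e = cong₂ _+_ (e x) (∑-cong xs e)

  ∑-cong-All : {xs : List A} {f g : A → ℕ} → All (λ x → f x ≡ g x) xs → ∑ xs f ≡ ∑ xs g
  ∑-cong-All [] = refl
  ∑-cong-All (e ∷ es) = cong₂ _+_ e (∑-cong-All es)

  ∑-zero : (xs : List A) → ∑ xs (λ _ → 0) ≡ 0
  ∑-zero [] = refl
  ∑-zero (x ∷ xs) = ∑-zero xs

  ∑-+ : (xs : List A) (f g : A → ℕ) → ∑ xs (λ x → f x + g x) ≡ ∑ xs f + ∑ xs g
  ∑-+ [] f g = refl
  ∑-+ (x ∷ xs) f g = begin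
    f x + g x + ∑ xs (λ x → f x + g x) ≡⟨ cong (f x + g x +_) (∑-+ xs f g) ⟩
    f x + g x + (∑ xs f + ∑ xs g)      ≡⟨ +-assoc (f x) (g x) _ ⟩
    f x + (g x + (∑ xs f + ∑ xs g))    ≡⟨ cong (f x +_) (x∙yz≈y∙xz (g x) (∑ xs f) (∑ xs g)) ⟩
    f x + (∑ xs f + (g x + ∑ xs g))    ≡⟨ +-assoc (f x) _ _ ⟨
    f x + ∑ xs f + (g x + ∑ xs g)      ∎
    where open import Algebra.Properties.CommutativeSemigroup +-commutativeSemigroup using (x∙yz≈y∙xz)

  ∑-*ˡ : (xs : List A) (c : ℕ) (f : A → ℕ) → ∑ xs (λ x → c * f x) ≡ c * ∑ xs f
  ∑-*ˡ [] c f = sym (*-zeroʳ c)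
  ∑-*ˡ (x ∷ xs) c f = trans (cong (c * f x +_) (∑-*ˡ xs c f)) (sym (*-distribˡ-+ c (f x) _))

  ∑-*ʳ : (xs : List A) (c : ℕ) (f : A → ℕ) → ∑ xs (λ x → f x * c) ≡ ∑ xs f * c
  ∑-*ʳ xs c f = trans (∑-cong xs (λ x → *-comm (f x) c)) (trans (∑-*ˡ xs c f) (*-comm c _))

  ∑-const : (xs : List A) (c : ℕ) → ∑ xs (λ _ → c) ≡ length xs * c
  ∑-const [] c = refl
  ∑-const (x ∷ xs) c = cong (c +_) (∑-const xs c)

  ∑-filterᵇ : (p : A → Bool) (xs : List A) (f : A → ℕ) →
              ∑ (filterᵇ p xs) f ≡ ∑ xs (λ x → 𝟙 (p x) * f x)
  ∑-filterᵇ p [] f = refl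
  ∑-filterᵇ p (x ∷ xs) f with p x
  ... | true  = cong₂ _+_ (sym (+-identityʳ (f x))) (∑-filterᵇ p xs f)
  ... | false = ∑-filterᵇ p xs f

  count-∑ : (p : A → Bool) (xs : List A) → count p xs ≡ ∑ xs (𝟙 ∘ p)
  count-∑ p [] = refl
  count-∑ p (x ∷ xs) with p x
  ... | true  = cong suc (count-∑ p xs)
  ... | false = count-∑ p xs

  filterᵇ-All : (p : A → Bool) (xs : List A) → All (λ x → p x ≡ true) (filterᵇ p xs)
  filterᵇ-All p [] = []
  filterᵇ-All p (x ∷ xs) with p x in e
  ... | true  = e ∷ filterᵇ-All p xs
  ... | false = filterᵇ-All p xs

module _ {A B : Set} where

  ∑-map : (g : A → B) (xs : List A) (f : B → ℕ) → ∑ (map g xs) f ≡ ∑ xs (f ∘ g)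
  ∑-map g xs f = cong sum (sym (map-∘ xs))

  ∑-++ : (xs ys : List B) (f : B → ℕ) → ∑ (xs List.++ ys) f ≡ ∑ xs f + ∑ ys f
  ∑-++ [] ys f = refl
  ∑-++ (x ∷ xs) ys f = trans (cong (f x +_) (∑-++ xs ys f)) (sym (+-assoc (f x) _ _))

  ∑-concatMap : (g : A → List B) (xs : List A) (f : B → ℕ) →
                ∑ (concatMap g xs) f ≡ ∑ xs (λ x → ∑ (g x) f)
  ∑-concatMap g [] f = refl
  ∑-concatMap g (x ∷ xs) f = trans (∑-++ (g x) _ f) (cong (∑ (g x) f +_) (∑-concatMap g xs f))

  ∑-swap : (xs : List A) (ys : List B) (f : A → B → ℕ) →
           ∑ xs (λ x → ∑ ys (f x)) ≡ ∑ ys (λ y → ∑ xs (λ x → f x y))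
  ∑-swap [] ys f = sym (∑-zero ys)
  ∑-swap (x ∷ xs) ys f = trans (cong (∑ ys (f x) +_) (∑-swap xs ys f))
                               (sym (∑-+ ys (f x) (λ y → ∑ xs (λ x → f x y))))

-- Boolean tests and the propositions they decide

reflects-⇔ : {P Q : Set} {a b : Bool} → Reflects P a → Reflects Q b → (P → Q) → (Q → P) → a ≡ b
reflects-⇔ (ofʸ p) (ofʸ q) f g = refl
reflects-⇔ (ofʸ p) (ofⁿ q) f g = contradiction (f p) q
reflects-⇔ (ofⁿ p) (ofʸ q) f g = contradiction (g q) p
reflects-⇔ (ofⁿ p) (ofⁿ q) f g = refl

reflects-map : {P Q : Set} {a : Bool} → (P → Q) → (Q → P) → Reflects P a → Reflects Q a
reflects-map f g (ofʸ p) = ofʸ (f p)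
reflects-map f g (ofⁿ p) = ofⁿ (p ∘ g)

reflects-true : {P : Set} {a : Bool} → Reflects P a → P → a ≡ true
reflects-true (ofʸ _) p = refl
reflects-true (ofⁿ q) p = contradiction p q

reflects-sound : {P : Set} {a : Bool} → Reflects P a → a ≡ true → P
reflects-sound (ofʸ p) _ = p

⌊⌋-reflects : {P : Set} (d : Dec P) → Reflects P ⌊ d ⌋
⌊⌋-reflects (yes p) = ofʸ p
⌊⌋-reflects (no p) = ofⁿ p

-- Under an indicator two values need to agree only where the indicator is 1. This is how membership
-- or invertibility becomes available as a hypothesis inside a sum over all matrices.
𝟙-guard : {P : Set} {b : Bool} → Reflects P b → {k l : ℕ} → (P → k ≡ l) → 𝟙 b * k ≡ 𝟙 b * l
𝟙-guard (ofʸ p) e = cong (_+ 0) (e p)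
𝟙-guard (ofⁿ _) e = refl

𝟙-∧ : ∀ a b → 𝟙 (a ∧ b) ≡ 𝟙 a * 𝟙 b
𝟙-∧ true b = sym (+-identityʳ _)
𝟙-∧ false b = refl

all-allFin : ∀ {n} (p : Fin (suc n) → Bool) →
             all p (allFin (suc n)) ≡ p zero ∧ all (p ∘ suc) (allFin n)
all-allFin {n} p = cong (λ l → p zero ∧ and l)
  (trans (map-tabulate suc p) (sym (map-tabulate (λ i → i) (p ∘ suc))))

all-reflects : ∀ {n} {P : Fin n → Set} {p : Fin n → Bool} →
               (∀ i → Reflects (P i) (p i)) → Reflects (∀ i → P i) (all p (allFin n))
all-reflects {zero} r = ofʸ (λ ())
all-reflects {suc n} {P} {p} r rewrite all-allFin p with p zero | r zero
... | false | ofⁿ ¬p = ofⁿ (λ f → ¬p (f zero))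
... | true  | ofʸ p₀ = reflects-map (λ { f zero → p₀ ; f (suc i) → f i }) (λ f i → f (suc i))
                                    (all-reflects (λ i → r (suc i)))

-- The field `once` expresses completeness and absence of repetition by one equation, in the form
-- that double counting uses. The relation is a parameter so that the same record covers field
-- elements and matrices compared entrywise.
record Enumeration {A : Set} (_≈_ : A → A → Set) : Set where
  field
    list : List A
    eqᵇ : A → A → Bool
    eq-reflects : ∀ a b → Reflects (a ≈ b) (eqᵇ a b)
    once : ∀ a → ∑ list (λ x → 𝟙 (eqᵇ a x)) ≡ 1

  open ≡-Reasoning

  ∑-pick : {f : A → ℕ} → (∀ {x y} → x ≈ y → f x ≡ f y) →
           ∀ a → ∑ list (λ x → 𝟙 (eqᵇ a x) * f x) ≡ f a
  ∑-pick {f} f-cong a = begin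
    ∑ list (λ x → 𝟙 (eqᵇ a x) * f x) ≡⟨ ∑-cong list (λ x → 𝟙-guard (eq-reflects a x) (λ e → sym (f-cong e))) ⟩
    ∑ list (λ x → 𝟙 (eqᵇ a x) * f a) ≡⟨ ∑-*ʳ list (f a) _ ⟩
    ∑ list (λ x → 𝟙 (eqᵇ a x)) * f a ≡⟨ cong (_* f a) (once a) ⟩
    1 * f a                           ≡⟨ *-identityˡ (f a) ⟩
    f a                               ∎

  -- A witness `a` is listed only up to `≈`, which is why `P` has to respect it. If the search
  -- failed, no entry would be equivalent to `a`, and its multiplicity would be 0 instead of 1.
  any-reflects : {P : A → Set} {p : A → Bool} → (∀ {x y} → x ≈ y → P x → P y) →
                 (∀ x → Reflects (P x) (p x)) → Reflects (∃ P) (any p list)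
  any-reflects {P} {p} P-resp r with any p list in e
  ... | true  = ofʸ (found list e)
    where
    found : ∀ xs → any p xs ≡ true → ∃ P
    found (x ∷ xs) e with p x | r x
    ... | true  | ofʸ px = x , px
    ... | false | ofⁿ _  = found xs e
  ... | false = ofⁿ (λ { (a , pa) → 0≢1+n (trans (sym (none a pa list e)) (once a)) })
    where
    none : ∀ a → P a → ∀ xs → any p xs ≡ false → ∑ xs (λ x → 𝟙 (eqᵇ a x)) ≡ 0
    none a pa [] e = refl
    none a pa (x ∷ xs) e with p x | r x | eqᵇ a x | eq-reflects a x
    ... | false | ofⁿ ¬px | true  | ofʸ a≈x = contradiction (P-resp a≈x pa) ¬px
    ... | false | ofⁿ ¬px | false | _       = none a pa xs e

-- Double counting of the pairs (a , b) with φ a ≈ b.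
∑-reindex-on : {A B : Set} {_≈₁_ : A → A → Set} {_≈₂_ : B → B → Set}
  (E₁ : Enumeration _≈₁_) (E₂ : Enumeration _≈₂_) {f : B → ℕ} →
  (∀ {x y} → x ≈₂ y → f x ≡ f y) →
  {P : A → Set} {p : A → Bool} (rp : ∀ a → Reflects (P a) (p a)) →
  {Q : B → Set} {q : B → Bool} (rq : ∀ b → Reflects (Q b) (q b)) →
  (φ : A → B) (ψ : B → A) →
  (∀ a b → P a → φ a ≈₂ b → Q b × (ψ b ≈₁ a)) → (∀ a b → Q b → ψ b ≈₁ a → P a × (φ a ≈₂ b)) →
  ∑ (Enumeration.list E₂) (λ b → 𝟙 (q b) * f b) ≡ ∑ (Enumeration.list E₁) (λ a → 𝟙 (p a) * f (φ a))
∑-reindex-on E₁ E₂ {f} f-cong {P} {p} rp {Q} {q} rq φ ψ to from = begin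
  ∑ ys (λ y → 𝟙 (q y) * f y)
    -- The factor 1 is written as the multiplicity of `ψ y` in `xs`, which creates the pairs to be
    -- counted.
    ≡⟨ ∑-cong ys (λ y → trans (sym (*-identityˡ _)) (trans (cong (_* (𝟙 (q y) * f y)) (sym (E₁.once (ψ y)))) (sym (∑-*ʳ xs _ _)))) ⟩
  ∑ ys (λ y → ∑ xs (λ x → 𝟙 (E₁.eqᵇ (ψ y) x) * (𝟙 (q y) * f y)))
    ≡⟨ ∑-swap ys xs _ ⟩
  ∑ xs (λ x → ∑ ys (λ y → 𝟙 (E₁.eqᵇ (ψ y) x) * (𝟙 (q y) * f y)))
    ≡⟨ ∑-cong xs (λ x → ∑-cong ys (λ y → exchange x y)) ⟩
  ∑ xs (λ x → ∑ ys (λ y → 𝟙 (p x) * (𝟙 (E₂.eqᵇ (φ x) y) * f y)))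
    ≡⟨ ∑-cong xs (λ x → trans (∑-*ˡ ys (𝟙 (p x)) _) (cong (𝟙 (p x) *_) (E₂.∑-pick f-cong (φ x)))) ⟩
  ∑ xs (λ x → 𝟙 (p x) * f (φ x)) ∎
  where
  open ≡-Reasoning
  module E₁ = Enumeration E₁
  module E₂ = Enumeration E₂
  xs = E₁.list
  ys = E₂.list
  -- Both sides weight the same pairs: `to` and `from` say that `P x` with `φ x ≈ y` is equivalent
  -- to `Q y` with `ψ y ≈ x`.
  exchange : ∀ x y → 𝟙 (E₁.eqᵇ (ψ y) x) * (𝟙 (q y) * f y) ≡ 𝟙 (p x) * (𝟙 (E₂.eqᵇ (φ x) y) * f y)
  exchange x y with E₁.eqᵇ (ψ y) x | E₁.eq-reflects (ψ y) x | q y | rq y | p x | rp x | E₂.eqᵇ (φ x) y | E₂.eq-reflects (φ x) y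
  ... | false | _      | _     | _      | false | _      | _     | _      = refl
  ... | false | _      | _     | _      | true  | _      | false | _      = refl
  ... | false | ofⁿ ¬a | _     | _      | true  | ofʸ px | true  | ofʸ b  = contradiction (proj₂ (to x y px b)) ¬a
  ... | true  | ofʸ a  | true  | ofʸ qy | false | ofⁿ ¬p | _     | _      = contradiction (proj₁ (from x y qy a)) ¬p
  ... | true  | ofʸ a  | true  | ofʸ qy | true  | ofʸ _  | false | ofⁿ ¬b = contradiction (proj₂ (from x y qy a)) ¬b
  ... | true  | _      | true  | _      | true  | _      | true  | _      = refl
  ... | true  | _      | false | _      | false | _      | _     | _      = refl
  ... | true  | _      | false | _      | true  | _      | false | _      = refl
  ... | true  | _      | false | ofⁿ ¬q | true  | ofʸ px | true  | ofʸ b  = contradiction (proj₁ (to x y px b)) ¬q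

∑-reindex : {A B : Set} {_≈₁_ : A → A → Set} {_≈₂_ : B → B → Set}
            (E₁ : Enumeration _≈₁_) (E₂ : Enumeration _≈₂_) {f : B → ℕ} →
            (∀ {x y} → x ≈₂ y → f x ≡ f y) → (φ : A → B) (ψ : B → A) →
            (∀ a b → φ a ≈₂ b → ψ b ≈₁ a) → (∀ a b → ψ b ≈₁ a → φ a ≈₂ b) →
            ∑ (Enumeration.list E₂) f ≡ ∑ (Enumeration.list E₁) (f ∘ φ)
∑-reindex E₁ E₂ f-cong φ ψ to from =
  trans (∑-cong (Enumeration.list E₂) (λ y → sym (*-identityˡ _)))
  (trans (∑-reindex-on E₁ E₂ f-cong {λ _ → ⊤} {λ _ → true} (λ _ → ofʸ tt) {λ _ → ⊤} {λ _ → true} (λ _ → ofʸ tt) φ ψ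
           (λ a b _ e → tt , to a b e) (λ a b _ e → tt , from a b e))
         (∑-cong (Enumeration.list E₁) (λ y → *-identityˡ _)))

-- Weighted counting of equivalence classes

any-false : {A : Set} (p : A → Bool) (x : A) (xs : List A) → any p (x ∷ xs) ≡ false → p x ≡ false × any p xs ≡ false
any-false p x xs e with p x
... | false = refl , e

module _ {A : Set} (R : A → A → Bool) (R-refl : ∀ x → R x x ≡ true)
         (R-sym : ∀ x y → R x y ≡ true → R y x ≡ true)
         (R-trans : ∀ x y z → R x y ≡ true → R y z ≡ true → R x z ≡ true)
         (w : A → ℕ) (N : ℕ) where

  open ≡-Reasoning

  private
    unseen : List A → A → ℕ
    unseen seen z = 𝟙 (not (any (λ s → R s z) seen))

    unseen-resp : ∀ seen x z → any (λ s → R s x) seen ≡ false → R x z ≡ true →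
                  any (λ s → R s z) seen ≡ false
    unseen-resp [] x z u r = refl
    unseen-resp (s ∷ seen) x z u r with any-false (λ s → R s x) s seen u
    ... | sx , u′ with R s z in sz
    ...   | true  = contradiction (trans (sym (R-trans s z x sz (R-sym x z r))) sx) λ ()
    ...   | false = unseen-resp seen x z u′ r

    split : ∀ seen x z → any (λ s → R s x) seen ≡ false →
            unseen seen z * w z ≡ 𝟙 (R x z) * w z + unseen (x ∷ seen) z * w z
    split seen x z u with R x z in r
    ... | false = refl
    ... | true rewrite unseen-resp seen x z u r = sym (+-identityʳ (w z + 0))

  -- The greedy count pays `N` at the first member of a class, for the weight of the whole class. No
  -- member of the class of an unseen entry has been passed before, so the hypothesis may sum over
  -- the remaining list alone, and it is demanded only of unseen entries.
  classesAux-∑ : ∀ seen xs →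
    All (λ x → any (λ s → R s x) seen ≡ false → ∑ xs (λ z → 𝟙 (R x z) * w z) ≡ N) xs →
    classesAux R seen xs * N ≡ ∑ xs (λ z → unseen seen z * w z)
  classesAux-∑ seen [] _ = refl
  classesAux-∑ seen (x ∷ xs) (hx ∷ hs) with any (λ s → R s x) seen in e
  ... | true = classesAux-∑ seen xs (go hs)
    where
    -- The entry `x` can leave the sums: it is related to a seen one, so no unseen `y` is related to
    -- it.
    go : ∀ {ys} → All (λ y → any (λ s → R s y) seen ≡ false → ∑ (x ∷ xs) (λ z → 𝟙 (R y z) * w z) ≡ N) ys →
         All (λ y → any (λ s → R s y) seen ≡ false → ∑ xs (λ z → 𝟙 (R y z) * w z) ≡ N) ys
    go [] = []
    go {y ∷ ys} (h ∷ hs) = shrink ∷ go hs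
      where
      shrink : any (λ s → R s y) seen ≡ false → ∑ xs (λ z → 𝟙 (R y z) * w z) ≡ N
      shrink u with R y x in r | h u
      ... | false | eq = eq
      ... | true  | _  = contradiction (trans (sym (unseen-resp seen y x u r)) e) λ ()
  ... | false = begin
    N + classesAux R (x ∷ seen) xs * N
      ≡⟨ cong₂ _+_ (sym (hx refl)) (classesAux-∑ (x ∷ seen) xs (go hs)) ⟩
    𝟙 (R x x) * w x + ∑ xs (λ z → 𝟙 (R x z) * w z) + ∑ xs (λ z → unseen (x ∷ seen) z * w z)
      ≡⟨ +-assoc (𝟙 (R x x) * w x) _ _ ⟩
    𝟙 (R x x) * w x + (∑ xs (λ z → 𝟙 (R x z) * w z) + ∑ xs (λ z → unseen (x ∷ seen) z * w z))
      ≡⟨ cong₂ _+_ (cong (λ b → 𝟙 b * w x) (R-refl x)) (sym (∑-+ xs _ _)) ⟩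
    1 * w x + ∑ xs (λ z → 𝟙 (R x z) * w z + unseen (x ∷ seen) z * w z)
      ≡⟨ cong (1 * w x +_) (∑-cong xs (λ z → sym (split seen x z e))) ⟩
    1 * w x + ∑ xs (λ z → unseen seen z * w z) ∎
    where
    -- Here `x` itself becomes seen, so an entry that stays unseen is unrelated to `x` and its sum
    -- loses nothing.
    go : ∀ {ys} → All (λ y → any (λ s → R s y) seen ≡ false → ∑ (x ∷ xs) (λ z → 𝟙 (R y z) * w z) ≡ N) ys →
         All (λ y → any (λ s → R s y) (x ∷ seen) ≡ false → ∑ xs (λ z → 𝟙 (R y z) * w z) ≡ N) ys
    go [] = []
    go {y ∷ ys} (h ∷ hs) = shrink ∷ go hs
      where
      shrink : any (λ s → R s y) (x ∷ seen) ≡ false → ∑ xs (λ z → 𝟙 (R y z) * w z) ≡ N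
      shrink u with any-false (λ s → R s y) x seen u
      ... | xy , u′ with R y x in r | h u′
      ...   | false | eq = eq
      ...   | true  | _  = contradiction (trans (sym (R-sym y x r)) xy) λ ()

  -- To be used with `w` the order of the stabilizer and `N` the order of the group: the
  -- orbit-stabilizer theorem provides the hypothesis, and the conclusion is Burnside's count.
  numClasses-∑ : ∀ xs → All (λ x → ∑ xs (λ z → 𝟙 (R x z) * w z) ≡ N) xs →
                 numClasses R xs * N ≡ ∑ xs w
  numClasses-∑ xs h = trans (classesAux-∑ [] xs (All.map (λ e _ → e) h))
                            (∑-cong xs (λ z → *-identityˡ (w z)))

-- Matrices over a finite field

foldr-allFin : {A B : Set} {n : ℕ} (c : B → A → A) (e : A) (f : Fin (suc n) → B) →
               foldr c e (map f (allFin (suc n))) ≡ c (f zero) (foldr c e (map (f ∘ suc) (allFin n)))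
foldr-allFin c e f = cong (λ l → c (f zero) (foldr c e l))
  (trans (map-tabulate suc f) (sym (map-tabulate (λ i → i) (f ∘ suc))))

commutativeRing : FiniteField → CommutativeRing _ _
commutativeRing 𝔽 = record { isCommutativeRing = FiniteField.isCommutativeRing 𝔽 }

module _ (𝔽 : FiniteField) where
  open FiniteField 𝔽 using (Carrier; _≟_; elements; complete; unique)

  private
    once-∈ : ∀ x xs → Unique xs → x ∈ xs → ∑ xs (λ y → 𝟙 ⌊ x ≟ y ⌋) ≡ 1
    none : ∀ x xs → All (x ≢_) xs → ∑ xs (λ y → 𝟙 ⌊ x ≟ y ⌋) ≡ 0
    none x [] [] = refl
    none x (y ∷ xs) (e ∷ es) with x ≟ y
    ... | yes p = contradiction p e
    ... | no _  = none x xs es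
    once-∈ x (y ∷ xs) (u ∷ us) m with x ≟ y | m
    ... | yes refl | _       = cong suc (none x xs u)
    ... | no x≢y   | here e  = contradiction e x≢y
    ... | no _     | there i = once-∈ x xs us i

  fieldEnumeration : Enumeration {Carrier} _≡_
  fieldEnumeration = record
    { list = elements
    ; eqᵇ = λ x y → ⌊ x ≟ y ⌋
    ; eq-reflects = λ x y → ⌊⌋-reflects (x ≟ y)
    ; once = λ x → once-∈ x elements unique (complete x)
    }

module _ (𝔽 : FiniteField) (n : ℕ) where
  open Matrices 𝔽 n using (allVecs)

  -- A condition imposed coordinate by coordinate allows independent choices. With all factors 1
  -- this shows that every vector is listed once; with factors 1 and q it gives the order of 𝔲_h.
  ∑-allVecs : {A : Set} (xs : List A) (k : ℕ) (p : Fin k → A → Bool) →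
    ∑ (allVecs xs k) (λ v → 𝟙 (all (λ i → p i (v i)) (allFin k))) ≡ product (tabulate (λ i → ∑ xs (λ a → 𝟙 (p i a))))
  ∑-allVecs xs zero p = refl
  ∑-allVecs {A} xs (suc k) p = begin
    ∑ (concatMap (λ a → map (a ∷ᶠ_) (allVecs xs k)) xs) F
      ≡⟨ ∑-concatMap _ xs F ⟩
    ∑ xs (λ a → ∑ (map (a ∷ᶠ_) (allVecs xs k)) F)
      ≡⟨ ∑-cong xs (λ a → trans (∑-map _ (allVecs xs k) F) (trans (∑-cong (allVecs xs k) (λ v →
           trans (cong 𝟙 (all-allFin (λ i → p i ((a ∷ᶠ v) i)))) (𝟙-∧ (p zero a) _)))
           (∑-*ˡ (allVecs xs k) (𝟙 (p zero a)) _))) ⟩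
    ∑ xs (λ a → 𝟙 (p zero a) * ∑ (allVecs xs k) (λ v → 𝟙 (all (λ i → p (suc i) (v i)) (allFin k))))
      ≡⟨ ∑-*ʳ xs _ (λ a → 𝟙 (p zero a)) ⟩
    ∑ xs (λ a → 𝟙 (p zero a)) * ∑ (allVecs xs k) (λ v → 𝟙 (all (λ i → p (suc i) (v i)) (allFin k)))
      ≡⟨ cong (∑ xs (λ a → 𝟙 (p zero a)) *_) (∑-allVecs xs k (p ∘ suc)) ⟩
    product (tabulate (λ i → ∑ xs (λ a → 𝟙 (p i a)))) ∎
    where
    open ≡-Reasoning
    F : (Fin (suc k) → A) → ℕ
    F v = 𝟙 (all (λ i → p i (v i)) (allFin (suc k)))

  product-ones : ∀ k (f : Fin k → ℕ) → (∀ i → f i ≡ 1) → product (tabulate f) ≡ 1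
  product-ones zero f e = refl
  product-ones (suc k) f e rewrite e zero = trans (+-identityʳ _) (product-ones k (f ∘ suc) (e ∘ suc))

  vecEnumeration : {A : Set} {_≈_ : A → A → Set} → Enumeration _≈_ → (k : ℕ) →
                   Enumeration {Fin k → A} (λ v w → ∀ i → v i ≈ w i)
  vecEnumeration E k = record
    { list = allVecs list k
    ; eqᵇ = λ v w → all (λ i → eqᵇ (v i) (w i)) (allFin k)
    ; eq-reflects = λ v w → all-reflects (λ i → eq-reflects (v i) (w i))
    ; once = λ v → trans (∑-allVecs list k (λ i → eqᵇ (v i))) (product-ones k _ (λ i → once (v i)))
    }
    where open Enumeration E

module MatrixAlgebra (𝔽 : FiniteField) (n : ℕ) where
  open Matrices 𝔽 n
  private module K = CommutativeRing (commutativeRing 𝔽)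
  open FiniteField 𝔽 using (Carrier; 0#; 1#; _≟_) renaming (_+_ to _+ᶠ_; _*_ to _*ᶠ_; -_ to -ᶠ_)
  open SemiringSum K.semiring using (sum-cong-≗; ∑-distrib-+; ∑-comm; *-distribˡ-sum; *-distribʳ-sum; sum-replicate-zero) renaming (sum to sumᶠ) public

  infix 4 _≈_
  _≈_ : Mat → Mat → Set
  A ≈ B = ∀ i j → A i j ≡ B i j

  -- The nested enumeration computes to `allMats` and to the test `_==_`, so facts about
  -- enumerations apply to the given definitions without transport.
  matEnumeration : Enumeration _≈_
  matEnumeration = vecEnumeration 𝔽 n (vecEnumeration 𝔽 n (fieldEnumeration 𝔽) n) n

  ==-reflects : ∀ A B → Reflects (A ≈ B) (A == B)
  ==-reflects = Enumeration.eq-reflects matEnumeration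

  sum-allFin : ∀ {k} (f : Fin k → Carrier) → foldr _+ᶠ_ 0# (map f (allFin k)) ≡ sumᶠ f
  sum-allFin {zero} f = refl
  sum-allFin {suc k} f = trans (foldr-allFin _+ᶠ_ 0# f) (cong (f zero +ᶠ_) (sum-allFin (f ∘ suc)))

  sum-zero : ∀ {k} (f : Fin k → Carrier) → (∀ i → f i ≡ 0#) → sumᶠ f ≡ 0#
  sum-zero {k} f e = trans (sum-cong-≗ e) (sum-replicate-zero k)

  sum-δ : ∀ {k} (i : Fin k) (f : Fin k → Carrier) → sumᶠ (λ l → (if ⌊ i ≟ᶠ l ⌋ then 1# else 0#) *ᶠ f l) ≡ f i
  sum-δ zero f = trans (cong₂ _+ᶠ_ (K.*-identityˡ _) (sum-zero (λ l → 0# *ᶠ f (suc l)) (λ l → K.zeroˡ _))) (K.+-identityʳ _)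
  sum-δ (suc i) f = trans (cong₂ _+ᶠ_ (K.zeroˡ _) (trans (sum-cong-≗ lemma) (sum-δ i (f ∘ suc)))) (K.+-identityˡ _)
    where
    lemma : ∀ l → (if ⌊ suc i ≟ᶠ suc l ⌋ then 1# else 0#) *ᶠ f (suc l) ≡ (if ⌊ i ≟ᶠ l ⌋ then 1# else 0#) *ᶠ f (suc l)
    lemma l with i ≟ᶠ l
    ... | yes _ = refl
    ... | no _  = refl

  sum-δʳ : ∀ {k} (i : Fin k) (f : Fin k → Carrier) → sumᶠ (λ l → f l *ᶠ (if ⌊ l ≟ᶠ i ⌋ then 1# else 0#)) ≡ f i
  sum-δʳ i f = trans (sum-cong-≗ (λ l → trans (K.*-comm _ _) (cong (λ b → (if b then 1# else 0#) *ᶠ f l)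
    (reflects-⇔ (⌊⌋-reflects (l ≟ᶠ i)) (⌊⌋-reflects (i ≟ᶠ l)) sym sym)))) (sum-δ i f)

  ·-entry : ∀ A B i j → (A · B) i j ≡ sumᶠ (λ k → A i k *ᶠ B k j)
  ·-entry A B i j = sum-allFin (λ k → A i k *ᶠ B k j)

  ⊖_ : Mat → Mat
  (⊖ A) i j = -ᶠ A i j

  O : Mat
  O i j = 0#

  ·-cong : ∀ {A A′ B B′} → A ≈ A′ → B ≈ B′ → A · B ≈ A′ · B′
  ·-cong {A} {A′} {B} {B′} a b i j = trans (·-entry A B i j) (trans
    (sum-cong-≗ (λ k → cong₂ _*ᶠ_ (a i k) (b k j))) (sym (·-entry A′ B′ i j)))

  ·-assoc : ∀ A B C → (A · B) · C ≈ A · (B · C)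
  ·-assoc A B C i j = begin
    ((A · B) · C) i j                                        ≡⟨ ·-entry (A · B) C i j ⟩
    sumᶠ (λ k → (A · B) i k *ᶠ C k j)                        ≡⟨ sum-cong-≗ (λ k → trans (cong (_*ᶠ C k j) (·-entry A B i k)) (*-distribʳ-sum (C k j) (λ l → A i l *ᶠ B l k))) ⟩
    sumᶠ (λ k → sumᶠ (λ l → A i l *ᶠ B l k *ᶠ C k j))        ≡⟨ ∑-comm (λ k l → A i l *ᶠ B l k *ᶠ C k j) ⟩
    sumᶠ (λ l → sumᶠ (λ k → A i l *ᶠ B l k *ᶠ C k j))        ≡⟨ sum-cong-≗ (λ l → sum-cong-≗ (λ k → K.*-assoc (A i l) (B l k) (C k j))) ⟩
    sumᶠ (λ l → sumᶠ (λ k → A i l *ᶠ (B l k *ᶠ C k j)))      ≡⟨ sum-cong-≗ (λ l → sym (trans (cong (A i l *ᶠ_) (·-entry B C l j)) (*-distribˡ-sum (A i l) (λ k → B l k *ᶠ C k j)))) ⟩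
    sumᶠ (λ l → A i l *ᶠ (B · C) l j)                        ≡⟨ ·-entry A (B · C) i j ⟨
    (A · (B · C)) i j                                        ∎
    where open ≡-Reasoning

  ·-identityˡ : ∀ A → I · A ≈ A
  ·-identityˡ A i j = trans (·-entry I A i j) (sum-δ i (λ k → A k j))

  ·-identityʳ : ∀ A → A · I ≈ A
  ·-identityʳ A i j = trans (·-entry A I i j) (sum-δʳ j (A i))

  ·-distribˡ : ∀ A B C → A · (B ⊕ C) ≈ (A · B) ⊕ (A · C)
  ·-distribˡ A B C i j = begin
    (A · (B ⊕ C)) i j                                         ≡⟨ ·-entry A (B ⊕ C) i j ⟩
    sumᶠ (λ k → A i k *ᶠ (B k j +ᶠ C k j))                    ≡⟨ sum-cong-≗ (λ k → K.distribˡ (A i k) (B k j) (C k j)) ⟩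
    sumᶠ (λ k → A i k *ᶠ B k j +ᶠ A i k *ᶠ C k j)             ≡⟨ ∑-distrib-+ (λ k → A i k *ᶠ B k j) (λ k → A i k *ᶠ C k j) ⟩
    sumᶠ (λ k → A i k *ᶠ B k j) +ᶠ sumᶠ (λ k → A i k *ᶠ C k j) ≡⟨ cong₂ _+ᶠ_ (·-entry A B i j) (·-entry A C i j) ⟨
    ((A · B) ⊕ (A · C)) i j                                   ∎
    where open ≡-Reasoning

  ·-distribʳ : ∀ A B C → (B ⊕ C) · A ≈ (B · A) ⊕ (C · A)
  ·-distribʳ A B C i j = begin
    ((B ⊕ C) · A) i j                                         ≡⟨ ·-entry (B ⊕ C) A i j ⟩
    sumᶠ (λ k → (B i k +ᶠ C i k) *ᶠ A k j)                    ≡⟨ sum-cong-≗ (λ k → K.distribʳ (A k j) (B i k) (C i k)) ⟩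
    sumᶠ (λ k → B i k *ᶠ A k j +ᶠ C i k *ᶠ A k j)             ≡⟨ ∑-distrib-+ (λ k → B i k *ᶠ A k j) (λ k → C i k *ᶠ A k j) ⟩
    sumᶠ (λ k → B i k *ᶠ A k j) +ᶠ sumᶠ (λ k → C i k *ᶠ A k j) ≡⟨ cong₂ _+ᶠ_ (·-entry B A i j) (·-entry C A i j) ⟨
    ((B · A) ⊕ (C · A)) i j                                   ∎
    where open ≡-Reasoning

  matRing : Ring _ _
  matRing = record
    { Carrier = Mat ; _≈_ = _≈_ ; _+_ = _⊕_ ; _*_ = _·_ ; -_ = ⊖_ ; 0# = O ; 1# = I
    ; isRing = record
      { +-isAbelianGroup = record
        { isGroup = record
          { isMonoid = record
            { isSemigroup = record
              { isMagma = record
                { isEquivalence = record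
                  { refl = λ i j → refl ; sym = λ e i j → sym (e i j) ; trans = λ e f i j → trans (e i j) (f i j) }
                ; ∙-cong = λ e f i j → cong₂ _+ᶠ_ (e i j) (f i j) }
              ; assoc = λ A B C i j → K.+-assoc (A i j) (B i j) (C i j) }
            ; identity = (λ A i j → K.+-identityˡ (A i j)) , (λ A i j → K.+-identityʳ (A i j)) }
          ; inverse = (λ A i j → K.-‿inverseˡ (A i j)) , (λ A i j → K.-‿inverseʳ (A i j))
          ; ⁻¹-cong = λ e i j → cong -ᶠ_ (e i j) }
        ; comm = λ A B i j → K.+-comm (A i j) (B i j) }
      ; *-cong = ·-cong
      ; *-assoc = ·-assoc
      ; *-identity = ·-identityˡ , ·-identityʳ
      ; distrib = ·-distribˡ , ·-distribʳ } }

  module M = Ring matRing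
  open import Algebra.Properties.Ring matRing public using (+-cancelˡ)
  open import Relation.Binary.Reasoning.Setoid M.setoid

  IsInverse : Mat → Mat → Set
  IsInverse g g′ = (g · g′ ≈ I) × (g′ · g ≈ I)

  Invertible : Mat → Set
  Invertible g = ∃ (IsInverse g)

  isInvertible-reflects : ∀ g → Reflects (Invertible g) (isInvertible g)
  isInvertible-reflects g = Enumeration.any-reflects matEnumeration
    (λ e (a , b) → M.trans (M.*-congˡ (M.sym e)) a , M.trans (M.*-congʳ (M.sym e)) b)
    (λ B → ==-reflects (g · B) I ×-reflects ==-reflects (B · g) I)

  Invertible-resp : ∀ {g h} → g ≈ h → Invertible g → Invertible h
  Invertible-resp e (g′ , a , b) = g′ , M.trans (M.*-congʳ (M.sym e)) a , M.trans (M.*-congˡ (M.sym e)) b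

  cancel-mid : ∀ {a b} x y → a · b ≈ I → (x · a) · (b · y) ≈ x · y
  cancel-mid {a} {b} x y e = begin
    (x · a) · (b · y) ≈⟨ M.*-assoc x a (b · y) ⟩
    x · (a · (b · y)) ≈⟨ M.*-congˡ (M.*-assoc a b y) ⟨
    x · ((a · b) · y) ≈⟨ M.*-congˡ (M.*-congʳ e) ⟩
    x · (I · y)       ≈⟨ M.*-congˡ (M.*-identityˡ y) ⟩
    x · y             ∎

  cancelˡ : ∀ {a b} y → a · b ≈ I → a · (b · y) ≈ y
  cancelˡ y e = M.trans (M.sym (M.*-assoc _ _ y)) (M.trans (M.*-congʳ e) (M.*-identityˡ y))

  cancelʳ : ∀ {a b} y → a · b ≈ I → (y · a) · b ≈ y
  cancelʳ y e = M.trans (M.*-assoc y _ _) (M.trans (M.*-congˡ e) (M.*-identityʳ y))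

  Inverse-· : ∀ {g g′ h h′} → IsInverse g g′ → IsInverse h h′ → IsInverse (g · h) (h′ · g′)
  Inverse-· {g} {g′} {h} {h′} (a , b) (c , d) =
    M.trans (cancel-mid g g′ c) a , M.trans (cancel-mid h′ h b) d

  ==-cong : ∀ {A A′ B B′} → A ≈ A′ → B ≈ B′ → (A == B) ≡ (A′ == B′)
  ==-cong a b = reflects-⇔ (==-reflects _ _) (==-reflects _ _)
    (λ e → M.trans (M.sym a) (M.trans e b)) (λ e → M.trans a (M.trans e (M.sym b)))

-- F[t]-modules and the existence of the Jordan form

-- Nonincreasing lists of positive numbers bounded by k.
data Part : ℕ → List ℕ → Set where
  []  : ∀ {k} → Part k []
  _∷_ : ∀ {k j μ} → suc j ≤ k → Part (suc j) μ → Part k (suc j ∷ μ)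

Part-mono : ∀ {k l μ} → k ≤ l → Part k μ → Part l μ
Part-mono k≤l [] = []
Part-mono k≤l (j<k ∷ p) = ≤-trans j<k k≤l ∷ p

module LinearAlgebra (𝔽 : FiniteField) where
  open FiniteField 𝔽 using (0#; 1#; _≟_; inverse) renaming (Carrier to F; _+_ to _+ᶠ_; _*_ to _*ᶠ_; -_ to -ᶠ_)
  module K = CommutativeRing (commutativeRing 𝔽)

  -- Vector spaces with propositional equality. Negatives come from the scalars: by `•-distribʳ` and
  -- `•-zero`, `(-ᶠ c) • z` cancels `c • z`.
  record Space : Set₁ where
    infixl 6 _⊞_
    infixr 7 _•_
    field
      V : Set
      _⊞_ : V → V → V
      _•_ : F → V → V
      𝟎 : V
      ⊞-assoc : ∀ u v w → (u ⊞ v) ⊞ w ≡ u ⊞ (v ⊞ w)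
      ⊞-comm : ∀ v w → v ⊞ w ≡ w ⊞ v
      ⊞-identityʳ : ∀ v → v ⊞ 𝟎 ≡ v
      •-distribˡ : ∀ c v w → c • (v ⊞ w) ≡ c • v ⊞ c • w
      •-distribʳ : ∀ c d v → (c +ᶠ d) • v ≡ c • v ⊞ d • v
      •-assoc : ∀ c d v → (c *ᶠ d) • v ≡ c • d • v
      •-identity : ∀ v → 1# • v ≡ v
      •-zero : ∀ v → 0# • v ≡ 𝟎

    ⊞-commutativeSemigroup : CommutativeSemigroup _ _
    ⊞-commutativeSemigroup = record { Carrier = V ; _≈_ = _≡_ ; _∙_ = _⊞_ ; isCommutativeSemigroup = record
      { isSemigroup = record { isMagma = record { isEquivalence = isEquivalence ; ∙-cong = cong₂ _⊞_ }
                             ; assoc = ⊞-assoc }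
      ; comm = ⊞-comm } }

    open CommutativeSemigroupProperties ⊞-commutativeSemigroup public using () renaming (interchange to ⊞-medial)

    ⊞-identityˡ : ∀ v → 𝟎 ⊞ v ≡ v
    ⊞-identityˡ v = trans (⊞-comm 𝟎 v) (⊞-identityʳ v)

    •-zeroʳ : ∀ c → c • 𝟎 ≡ 𝟎
    •-zeroʳ c = trans (cong (c •_) (sym (•-zero 𝟎))) (trans (sym (•-assoc c 0# 𝟎)) (trans (cong (_• 𝟎) (K.zeroʳ c)) (•-zero 𝟎)))

    ⊞-cancel : ∀ {c d} w z → c +ᶠ d ≡ 0# → (w ⊞ c • z) ⊞ d • z ≡ w
    ⊞-cancel {c} {d} w z e = begin
      (w ⊞ c • z) ⊞ d • z ≡⟨ ⊞-assoc w _ _ ⟩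
      w ⊞ (c • z ⊞ d • z) ≡⟨ cong (w ⊞_) (•-distribʳ c d z) ⟨
      w ⊞ (c +ᶠ d) • z     ≡⟨ cong (λ e → w ⊞ e • z) e ⟩
      w ⊞ 0# • z          ≡⟨ cong (w ⊞_) (•-zero z) ⟩
      w ⊞ 𝟎               ≡⟨ ⊞-identityʳ w ⟩
      w                   ∎
      where open ≡-Reasoning

  record IsLinear (S S′ : Space) (f : Space.V S → Space.V S′) : Set where
    private
      module S = Space S
      module S′ = Space S′
    field
      ⊞-homo : ∀ v w → f (v S.⊞ w) ≡ f v S′.⊞ f w
      •-homo : ∀ c v → f (c S.• v) ≡ c S′.• f v

    𝟎-homo : f S.𝟎 ≡ S′.𝟎
    𝟎-homo = trans (cong f (sym (S.•-zero S.𝟎))) (trans (•-homo 0# S.𝟎) (S′.•-zero _))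

  -- A space with an endomorphism, i.e. an F[t]-module.
  record Mod : Set₁ where
    field
      space : Space
    open Space space public
    field
      T : V → V
      T-linear : IsLinear space space T
    open IsLinear T-linear public renaming (⊞-homo to T-⊞; •-homo to T-•; 𝟎-homo to T-𝟎)

  infix 4 _≅_
  record _≅_ (M N : Mod) : Set where
    module M = Mod M
    module N = Mod N
    field
      to : M.V → N.V
      from : N.V → M.V
      to-linear : IsLinear M.space N.space to
      to-T : ∀ v → to (M.T v) ≡ N.T (to v)
      from-to : ∀ v → from (to v) ≡ v
      to-from : ∀ w → to (from w) ≡ w

  ≅-sym : ∀ {M N} → M ≅ N → N ≅ M
  ≅-sym {M} {N} φ = record
    { to = from ; from = to
    ; to-linear = record
      { ⊞-homo = λ v w → trans (cong from (sym (trans (⊞-homo _ _) (cong₂ N._⊞_ (to-from v) (to-from w))))) (from-to _)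
      ; •-homo = λ c v → trans (cong from (sym (trans (•-homo _ _) (cong (c N.•_) (to-from v))))) (from-to _) }
    ; to-T = λ v → trans (cong from (sym (trans (to-T _) (cong N.T (to-from v))))) (from-to _)
    ; from-to = to-from ; to-from = from-to }
    where
    open _≅_ φ
    open IsLinear to-linear

  ≅-trans : ∀ {M N P} → M ≅ N → N ≅ P → M ≅ P
  ≅-trans φ ψ = record
    { to = ψ.to ∘ φ.to ; from = φ.from ∘ ψ.from
    ; to-linear = record
      { ⊞-homo = λ v w → trans (cong ψ.to (φ₁.⊞-homo v w)) (ψ₁.⊞-homo _ _)
      ; •-homo = λ c v → trans (cong ψ.to (φ₁.•-homo c v)) (ψ₁.•-homo _ _) }
    ; to-T = λ v → trans (cong ψ.to (φ.to-T v)) (ψ.to-T _)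
    ; from-to = λ v → trans (cong φ.from (ψ.from-to _)) (φ.from-to v)
    ; to-from = λ v → trans (cong ψ.to (φ.to-from _)) (ψ.to-from v) }
    where
    module φ = _≅_ φ
    module ψ = _≅_ ψ
    module φ₁ = IsLinear φ.to-linear
    module ψ₁ = IsLinear ψ.to-linear

  ≅-refl : ∀ {M} → M ≅ M
  ≅-refl = record { to = id ; from = id ; to-linear = record { ⊞-homo = λ _ _ → refl ; •-homo = λ _ _ → refl }
                  ; to-T = λ _ → refl ; from-to = λ _ → refl ; to-from = λ _ → refl }

  unit : Mod
  unit = record
    { space = record
      { V = ⊤ ; _⊞_ = λ _ _ → tt ; _•_ = λ _ _ → tt ; 𝟎 = tt
      ; ⊞-assoc = λ _ _ _ → refl ; ⊞-comm = λ _ _ → refl ; ⊞-identityʳ = λ _ → refl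
      ; •-distribˡ = λ _ _ _ → refl ; •-distribʳ = λ _ _ _ → refl ; •-assoc = λ _ _ _ → refl
      ; •-identity = λ _ → refl ; •-zero = λ _ → refl }
    ; T = id ; T-linear = record { ⊞-homo = λ _ _ → refl ; •-homo = λ _ _ → refl } }

  scalars : Space
  scalars = record
    { V = F ; _⊞_ = _+ᶠ_ ; _•_ = _*ᶠ_ ; 𝟎 = 0#
    ; ⊞-assoc = K.+-assoc ; ⊞-comm = K.+-comm ; ⊞-identityʳ = K.+-identityʳ
    ; •-distribˡ = K.distribˡ ; •-distribʳ = λ c d v → K.distribʳ v c d ; •-assoc = K.*-assoc
    ; •-identity = K.*-identityˡ ; •-zero = K.zeroˡ }

  infixr 5 _⊗_ _⊗ₛ_
  _⊗ₛ_ : Space → Space → Space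
  S ⊗ₛ S′ = record
    { V = S.V × S′.V ; _⊞_ = λ (a , b) (c , d) → a S.⊞ c , b S′.⊞ d ; _•_ = λ c (a , b) → c S.• a , c S′.• b
    ; 𝟎 = S.𝟎 , S′.𝟎
    ; ⊞-assoc = λ _ _ _ → cong₂ _,_ (S.⊞-assoc _ _ _) (S′.⊞-assoc _ _ _)
    ; ⊞-comm = λ _ _ → cong₂ _,_ (S.⊞-comm _ _) (S′.⊞-comm _ _)
    ; ⊞-identityʳ = λ _ → cong₂ _,_ (S.⊞-identityʳ _) (S′.⊞-identityʳ _)
    ; •-distribˡ = λ _ _ _ → cong₂ _,_ (S.•-distribˡ _ _ _) (S′.•-distribˡ _ _ _)
    ; •-distribʳ = λ _ _ _ → cong₂ _,_ (S.•-distribʳ _ _ _) (S′.•-distribʳ _ _ _)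
    ; •-assoc = λ _ _ _ → cong₂ _,_ (S.•-assoc _ _ _) (S′.•-assoc _ _ _)
    ; •-identity = λ _ → cong₂ _,_ (S.•-identity _) (S′.•-identity _)
    ; •-zero = λ _ → cong₂ _,_ (S.•-zero _) (S′.•-zero _) }
    where
    module S = Space S
    module S′ = Space S′

  _⊗_ : Mod → Mod → Mod
  M ⊗ N = record
    { space = M.space ⊗ₛ N.space ; T = λ (v , w) → M.T v , N.T w
    ; T-linear = record { ⊞-homo = λ _ _ → cong₂ _,_ (M.T-⊞ _ _) (N.T-⊞ _ _)
                        ; •-homo = λ _ _ → cong₂ _,_ (M.T-• _ _) (N.T-• _ _) } }
    where
    module M = Mod M
    module N = Mod N

  -- M extended by a basis vector e with T e = a.
  Ext : (M : Mod) → Mod.V M → Mod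
  Ext M a = record
    { space = scalars ⊗ₛ space ; T = λ (c , w) → 0# , c • a ⊞ T w
    ; T-linear = record
      { ⊞-homo = λ (c , v) (d , w) → cong₂ _,_ (sym (K.+-identityʳ 0#))
          (trans (cong₂ _⊞_ (•-distribʳ c d a) (T-⊞ v w)) (⊞-medial _ _ _ _))
      ; •-homo = λ c (d , w) → cong₂ _,_ (sym (K.zeroʳ c))
          (trans (cong₂ _⊞_ (•-assoc c d a) (T-• c w)) (sym (•-distribˡ c _ _))) } }
    where open Mod M

  vecSpace : ℕ → Space
  vecSpace m = record
    { V = Vec F m ; _⊞_ = zipWith _+ᶠ_ ; _•_ = λ c → Vec.map (c *ᶠ_) ; 𝟎 = replicate m 0#
    ; ⊞-assoc = assoc ; ⊞-comm = comm ; ⊞-identityʳ = identityʳ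
    ; •-distribˡ = distˡ ; •-distribʳ = distʳ ; •-assoc = •assoc ; •-identity = ident ; •-zero = zer }
    where
    assoc : ∀ {m} (u v w : Vec F m) → zipWith _+ᶠ_ (zipWith _+ᶠ_ u v) w ≡ zipWith _+ᶠ_ u (zipWith _+ᶠ_ v w)
    assoc [] [] [] = refl
    assoc (x ∷ u) (y ∷ v) (z ∷ w) = cong₂ _∷_ (K.+-assoc x y z) (assoc u v w)
    comm : ∀ {m} (u v : Vec F m) → zipWith _+ᶠ_ u v ≡ zipWith _+ᶠ_ v u
    comm [] [] = refl
    comm (x ∷ u) (y ∷ v) = cong₂ _∷_ (K.+-comm x y) (comm u v)
    identityʳ : ∀ {m} (u : Vec F m) → zipWith _+ᶠ_ u (replicate m 0#) ≡ u
    identityʳ [] = refl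
    identityʳ (x ∷ u) = cong₂ _∷_ (K.+-identityʳ x) (identityʳ u)
    distˡ : ∀ {m} c (u v : Vec F m) → Vec.map (c *ᶠ_) (zipWith _+ᶠ_ u v) ≡ zipWith _+ᶠ_ (Vec.map (c *ᶠ_) u) (Vec.map (c *ᶠ_) v)
    distˡ c [] [] = refl
    distˡ c (x ∷ u) (y ∷ v) = cong₂ _∷_ (K.distribˡ c x y) (distˡ c u v)
    distʳ : ∀ {m} c d (u : Vec F m) → Vec.map ((c +ᶠ d) *ᶠ_) u ≡ zipWith _+ᶠ_ (Vec.map (c *ᶠ_) u) (Vec.map (d *ᶠ_) u)
    distʳ c d [] = refl
    distʳ c d (x ∷ u) = cong₂ _∷_ (K.distribʳ x c d) (distʳ c d u)
    •assoc : ∀ {m} c d (u : Vec F m) → Vec.map ((c *ᶠ d) *ᶠ_) u ≡ Vec.map (c *ᶠ_) (Vec.map (d *ᶠ_) u)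
    •assoc c d [] = refl
    •assoc c d (x ∷ u) = cong₂ _∷_ (K.*-assoc c d x) (•assoc c d u)
    ident : ∀ {m} (u : Vec F m) → Vec.map (1# *ᶠ_) u ≡ u
    ident [] = refl
    ident (x ∷ u) = cong₂ _∷_ (K.*-identityˡ x) (ident u)
    zer : ∀ {m} (u : Vec F m) → Vec.map (0# *ᶠ_) u ≡ replicate m 0#
    zer [] = refl
    zer (x ∷ u) = cong₂ _∷_ (K.zeroˡ x) (zer u)

  shift : ∀ {m} → F → Vec F m → Vec F m
  shift c [] = []
  shift c (x ∷ v) = c ∷ shift x v

  module _ {m : ℕ} where
    open Space (vecSpace m) public using () renaming (_⊞_ to _⊞ᵛ_; _•_ to _•ᵛ_; 𝟎 to 𝟎ᵛ)

  shift-⊞ : ∀ {m} c d (v w : Vec F m) → shift (c +ᶠ d) (v ⊞ᵛ w) ≡ shift c v ⊞ᵛ shift d w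
  shift-⊞ c d [] [] = refl
  shift-⊞ c d (x ∷ v) (y ∷ w) = cong (c +ᶠ d ∷_) (shift-⊞ x y v w)

  shift-• : ∀ {m} c d (v : Vec F m) → shift (c *ᶠ d) (c •ᵛ v) ≡ c •ᵛ shift d v
  shift-• c d [] = refl
  shift-• c d (x ∷ v) = cong (c *ᶠ d ∷_) (shift-• c x v)

  -- The nilpotent Jordan block F[t]/(t^m), coordinates with respect to 1, t, …, t^(m-1).
  block : ℕ → Mod
  block m = record
    { space = vecSpace m ; T = shift 0#
    ; T-linear = record
      { ⊞-homo = λ v w → trans (cong (λ z → shift z (v ⊞ᵛ w)) (sym (K.+-identityʳ 0#))) (shift-⊞ 0# 0# v w)
      ; •-homo = λ c v → trans (cong (λ z → shift z (c •ᵛ v)) (sym (K.zeroʳ c))) (shift-• c 0# v) } }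

  jordan : List ℕ → Mod
  jordan [] = unit
  jordan (m ∷ μ) = block m ⊗ jordan μ

  ⊗-congʳ : ∀ {M N P} → N ≅ P → M ⊗ N ≅ M ⊗ P
  ⊗-congʳ φ = record
    { to = λ (v , w) → v , to w ; from = λ (v , w) → v , from w
    ; to-linear = record { ⊞-homo = λ _ _ → cong (_ ,_) (⊞-homo _ _) ; •-homo = λ _ _ → cong (_ ,_) (•-homo _ _) }
    ; to-T = λ _ → cong (_ ,_) (to-T _)
    ; from-to = λ _ → cong (_ ,_) (from-to _) ; to-from = λ _ → cong (_ ,_) (to-from _) }
    where
    open _≅_ φ
    open IsLinear to-linear

  ⊗-congˡ : ∀ {M N P} → M ≅ N → M ⊗ P ≅ N ⊗ P
  ⊗-congˡ φ = record
    { to = λ (v , w) → to v , w ; from = λ (v , w) → from v , w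
    ; to-linear = record { ⊞-homo = λ _ _ → cong (_, _) (⊞-homo _ _) ; •-homo = λ _ _ → cong (_, _) (•-homo _ _) }
    ; to-T = λ _ → cong (_, _) (to-T _)
    ; from-to = λ _ → cong (_, _) (from-to _) ; to-from = λ _ → cong (_, _) (to-from _) }
    where
    open _≅_ φ
    open IsLinear to-linear

  ⊗-swap : ∀ {M N P} → M ⊗ N ⊗ P ≅ N ⊗ M ⊗ P
  ⊗-swap = record
    { to = λ (u , v , w) → v , u , w ; from = λ (u , v , w) → v , u , w
    ; to-linear = record { ⊞-homo = λ _ _ → refl ; •-homo = λ _ _ → refl }
    ; to-T = λ _ → refl ; from-to = λ _ → refl ; to-from = λ _ → refl }

  Ext-cong : ∀ {M N} (φ : M ≅ N) (a : Mod.V M) → Ext M a ≅ Ext N (_≅_.to φ a)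
  Ext-cong {M} {N} φ a = record
    { to = λ (c , w) → c , to w ; from = λ (c , w) → c , from w
    ; to-linear = record { ⊞-homo = λ _ _ → cong (_ ,_) (⊞-homo _ _) ; •-homo = λ _ _ → cong (_ ,_) (•-homo _ _) }
    ; to-T = λ (c , w) → cong (0# ,_) (trans (⊞-homo _ _) (cong₂ N._⊞_ (•-homo c a) (to-T w)))
    ; from-to = λ _ → cong (_ ,_) (from-to _) ; to-from = λ _ → cong (_ ,_) (to-from _) }
    where
    open _≅_ φ
    open IsLinear to-linear

  -- Change of basis e ↦ e + z.
  Ext-shear : ∀ {M} {a a′} z → a′ ≡ Mod._⊞_ M a (Mod.T M z) → Ext M a′ ≅ Ext M a
  Ext-shear {M} {a} z refl = record
    { to = λ (c , w) → c , w ⊞ c • z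
    ; from = λ (c , w) → c , w ⊞ (-ᶠ c) • z
    ; to-linear = record
      { ⊞-homo = λ (c , v) (d , w) → cong (_ ,_) (trans (cong (v ⊞ w ⊞_) (•-distribʳ c d z)) (⊞-medial _ _ _ _))
      ; •-homo = λ c (d , w) → cong (_ ,_) (trans (cong (c • w ⊞_) (•-assoc c d z)) (sym (•-distribˡ c _ _))) }
    ; to-T = λ (c , w) → cong (0# ,_) (begin
        c • (a ⊞ T z) ⊞ T w ⊞ 0# • z   ≡⟨ cong (c • (a ⊞ T z) ⊞ T w ⊞_) (•-zero z) ⟩
        c • (a ⊞ T z) ⊞ T w ⊞ 𝟎        ≡⟨ ⊞-identityʳ _ ⟩
        c • (a ⊞ T z) ⊞ T w            ≡⟨ cong (_⊞ T w) (•-distribˡ c a (T z)) ⟩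
        c • a ⊞ c • T z ⊞ T w          ≡⟨ ⊞-assoc _ _ _ ⟩
        c • a ⊞ (c • T z ⊞ T w)        ≡⟨ cong (c • a ⊞_) (⊞-comm _ _) ⟩
        c • a ⊞ (T w ⊞ c • T z)        ≡⟨ cong (λ u → c • a ⊞ (T w ⊞ u)) (T-• c z) ⟨
        c • a ⊞ (T w ⊞ T (c • z))      ≡⟨ cong (c • a ⊞_) (T-⊞ w (c • z)) ⟨
        c • a ⊞ T (w ⊞ c • z)          ∎)
    ; from-to = λ (c , w) → cong (c ,_) (⊞-cancel w z (K.-‿inverseʳ c))
    ; to-from = λ (c , w) → cong (c ,_) (⊞-cancel w z (K.-‿inverseˡ c)) }
    where
    open Mod M
    open ≡-Reasoning

  -- A new basis vector with image `c • a` is `c` times one with image `a`, and `c` is a unit.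
  Ext-scale : ∀ {M} {c c′} a → c *ᶠ c′ ≡ 1# → Ext M (Mod._•_ M c a) ≅ Ext M a
  Ext-scale {M} {c} {c′} a cc′ = record
    { to = λ (d , w) → d *ᶠ c , w
    ; from = λ (d , w) → d *ᶠ c′ , w
    ; to-linear = record { ⊞-homo = λ (d , _) (e , _) → cong (_, _) (K.distribʳ c d e)
                         ; •-homo = λ d (e , _) → cong (_, _) (K.*-assoc d e c) }
    ; to-T = λ (d , w) → cong₂ _,_ (K.zeroˡ c) (cong (_⊞ T w) (sym (•-assoc d c a)))
    ; from-to = λ (d , w) → cong (_, w) (trans (K.*-assoc d c c′) (trans (cong (d *ᶠ_) cc′) (K.*-identityʳ d)))
    ; to-from = λ (d , w) → cong (_, w) (trans (K.*-assoc d c′ c) (trans (cong (d *ᶠ_) (trans (K.*-comm c′ c) cc′)) (K.*-identityʳ d))) }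
    where open Mod M

  -- Because `h` commutes with T, the shear `(y , w) ↦ (y , w ⊞ h y)` is an automorphism of `M ⊗ N`.
  -- It moves `(x , 𝟎)` to `(x , h x)`, so a second component of the form `h x` can be removed.
  Ext-hom : ∀ {M N} (h : Mod.V M → Mod.V N) → IsLinear (Mod.space M) (Mod.space N) h →
            (∀ v → h (Mod.T M v) ≡ Mod.T N (h v)) →
            ∀ x → Ext (M ⊗ N) (x , Mod.𝟎 N) ≅ Ext (M ⊗ N) (x , h x)
  Ext-hom {M} {N} h h-linear h-T x = record
    { to = λ (c , y , w) → c , y , w ⊞ h y
    ; from = λ (c , y , w) → c , y , w ⊞ (-ᶠ 1#) • h y
    ; to-linear = record
      { ⊞-homo = λ (_ , y , v) (_ , z , w) → cong (λ u → _ , _ , u) (trans (cong (v ⊞ w ⊞_) (⊞-homo y z)) (⊞-medial _ _ _ _))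
      ; •-homo = λ c (_ , y , w) → cong (λ u → _ , _ , u) (trans (cong (c • w ⊞_) (•-homo c y)) (sym (•-distribˡ c _ _))) }
    ; to-T = λ (c , y , w) → cong (λ u → 0# , c M.• x M.⊞ M.T y , u) (begin
        c • 𝟎 ⊞ T w ⊞ h (c M.• x M.⊞ M.T y)  ≡⟨ cong (λ u → u ⊞ T w ⊞ h (c M.• x M.⊞ M.T y)) (•-zeroʳ c) ⟩
        𝟎 ⊞ T w ⊞ h (c M.• x M.⊞ M.T y)      ≡⟨ cong₂ _⊞_ (⊞-identityˡ (T w)) (trans (⊞-homo _ _) (cong₂ _⊞_ (•-homo c x) (h-T y))) ⟩
        T w ⊞ (c • h x ⊞ T (h y))            ≡⟨ ⊞-assoc _ _ _ ⟨
        T w ⊞ c • h x ⊞ T (h y)              ≡⟨ cong (_⊞ T (h y)) (⊞-comm _ _) ⟩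
        c • h x ⊞ T w ⊞ T (h y)              ≡⟨ ⊞-assoc _ _ _ ⟩
        c • h x ⊞ (T w ⊞ T (h y))            ≡⟨ cong (c • h x ⊞_) (T-⊞ w (h y)) ⟨
        c • h x ⊞ T (w ⊞ h y)                ∎)
    ; from-to = λ (c , y , w) → cong (λ u → c , y , u)
        (trans (cong (λ u → w ⊞ u ⊞ (-ᶠ 1#) • h y) (sym (•-identity (h y)))) (⊞-cancel w (h y) (K.-‿inverseʳ 1#)))
    ; to-from = λ (c , y , w) → cong (λ u → c , y , u)
        (trans (cong (w ⊞ (-ᶠ 1#) • h y ⊞_) (sym (•-identity (h y)))) (⊞-cancel w (h y) (K.-‿inverseˡ 1#))) }
    where
    module M = Mod M
    open Mod N
    open IsLinear h-linear
    open ≡-Reasoning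

  Ext-⊗ˡ : ∀ {M N} x → Ext (M ⊗ N) (x , Mod.𝟎 N) ≅ Ext M x ⊗ N
  Ext-⊗ˡ {M} {N} x = record
    { to = λ (c , y , w) → (c , y) , w ; from = λ ((c , y) , w) → c , y , w
    ; to-linear = record { ⊞-homo = λ _ _ → refl ; •-homo = λ _ _ → refl }
    ; to-T = λ (c , y , w) → cong (_ ,_) (trans (cong (_⊞ T w) (•-zeroʳ c)) (⊞-identityˡ (T w)))
    ; from-to = λ _ → refl ; to-from = λ _ → refl }
    where open Mod N

  Ext-⊗ʳ : ∀ {M N} b → Ext (M ⊗ N) (Mod.𝟎 M , b) ≅ M ⊗ Ext N b
  Ext-⊗ʳ {M} {N} b = record
    { to = λ (c , y , w) → y , c , w ; from = λ (y , c , w) → c , y , w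
    ; to-linear = record { ⊞-homo = λ _ _ → refl ; •-homo = λ _ _ → refl }
    ; to-T = λ (c , y , w) → cong (_, _) (trans (cong (_⊞ T y) (•-zeroʳ c)) (⊞-identityˡ (T y)))
    ; from-to = λ _ → refl ; to-from = λ _ → refl }
    where open Mod M

  Ext-unit : Ext unit tt ≅ jordan (1 ∷ [])
  Ext-unit = record
    { to = λ (c , _) → (c ∷ []) , tt ; from = λ { ((c ∷ []) , _) → c , tt }
    ; to-linear = record { ⊞-homo = λ _ _ → refl ; •-homo = λ _ _ → refl }
    ; to-T = λ _ → refl ; from-to = λ _ → refl ; to-from = λ { ((c ∷ []) , _) → refl } }

  -- The class of 1, the cyclic generator of F[t]/(t^(m+1)).
  gen : ∀ m → Vec F (suc m)
  gen m = 1# ∷ replicate m 0#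

  gen-shift : ∀ {m} c (y : Vec F (suc m)) → c •ᵛ gen m ⊞ᵛ shift 0# y ≡ shift c y
  gen-shift {m} c (x ∷ y) = cong₂ _∷_ (trans (K.+-identityʳ _) (K.*-identityʳ c))
    (trans (cong (_⊞ᵛ shift x y) (Space.•-zeroʳ (vecSpace m) c)) (Space.⊞-identityˡ (vecSpace m) (shift x y)))

  -- If `T e` is the old generator, then `e` is a new one: the old basis 1, t, ..., t^m becomes t e,
  -- t² e, ..., t^(m+1) e, and the coefficient of `e` goes in front.
  Ext-gen : ∀ m → Ext (block (suc m)) (gen m) ≅ block (suc (suc m))
  Ext-gen m = record
    { to = λ (c , y) → c ∷ y ; from = λ { (c ∷ y) → c , y }
    ; to-linear = record { ⊞-homo = λ _ _ → refl ; •-homo = λ _ _ → refl }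
    ; to-T = λ (c , y) → cong (0# ∷_) (gen-shift c y)
    ; from-to = λ _ → refl ; to-from = λ { (c ∷ y) → refl } }

  -- Homomorphisms from a Jordan block

  module _ (M : Mod) where
    open Mod M

    T^ : ℕ → V → V
    T^ zero v = v
    T^ (suc k) v = T^ k (T v)

    T^-𝟎 : ∀ k → T^ k 𝟎 ≡ 𝟎
    T^-𝟎 zero = refl
    T^-𝟎 (suc k) = trans (cong (T^ k) T-𝟎) (T^-𝟎 k)

    -- eval b y = y(T) b, for the polynomial with coefficients y.
    eval : ∀ {m} → V → Vec F m → V
    eval b [] = 𝟎
    eval b (y ∷ ys) = y • b ⊞ eval (T b) ys

    eval-linear : ∀ {m} b → IsLinear (vecSpace m) space (eval b)
    eval-linear b = record { ⊞-homo = homo₁ b ; •-homo = homo₂ b }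
      where
      homo₁ : ∀ {m} b (v w : Vec F m) → eval b (v ⊞ᵛ w) ≡ eval b v ⊞ eval b w
      homo₁ b [] [] = sym (⊞-identityʳ 𝟎)
      homo₁ b (x ∷ v) (y ∷ w) = trans (cong₂ _⊞_ (•-distribʳ x y b) (homo₁ (T b) v w)) (⊞-medial _ _ _ _)
      homo₂ : ∀ {m} b c (v : Vec F m) → eval b (c •ᵛ v) ≡ c • eval b v
      homo₂ b c [] = sym (•-zeroʳ c)
      homo₂ b c (x ∷ v) = trans (cong₂ _⊞_ (•-assoc c x b) (homo₂ (T b) c v)) (sym (•-distribˡ c _ _))

    -- The coefficient that `shift` drops at the end would multiply T^m b, which is 0. The entering
    -- scalar `c` is arbitrary because in the recursion it is the preceding coefficient.
    eval-shift : ∀ {m} b → T^ m b ≡ 𝟎 → ∀ c (y : Vec F m) → eval b (shift c y) ≡ c • b ⊞ T (eval b y)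
    eval-shift b b0 c [] = sym (trans (cong₂ _⊞_ (trans (cong (c •_) b0) (•-zeroʳ c)) T-𝟎) (⊞-identityʳ 𝟎))
    eval-shift b b0 c (x ∷ y) = cong (c • b ⊞_) (trans (eval-shift (T b) b0 x y)
      (trans (cong (_⊞ T (eval (T b) y)) (sym (T-• x b))) (sym (T-⊞ _ _))))

    eval-T : ∀ {m} b → T^ m b ≡ 𝟎 → (y : Vec F m) → eval b (shift 0# y) ≡ T (eval b y)
    eval-T b b0 y = trans (eval-shift b b0 0# y) (trans (cong (_⊞ T (eval b y)) (•-zero b)) (⊞-identityˡ _))

    eval-zero : ∀ {m} b → eval b (replicate m 0#) ≡ 𝟎
    eval-zero {m} b = IsLinear.𝟎-homo (eval-linear {m} b)

    eval-gen : ∀ {m} b → eval b (gen m) ≡ b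
    eval-gen {m} b = trans (cong₂ _⊞_ (•-identity b) (eval-zero {m} (T b))) (⊞-identityʳ b)

  T^-⊗ : ∀ M N k v w → T^ (M ⊗ N) k (v , w) ≡ (T^ M k v , T^ N k w)
  T^-⊗ M N zero v w = refl
  T^-⊗ M N (suc k) v w = T^-⊗ M N k _ _

  shift-0∷ : ∀ {m} k (v : Vec F m) → T^ (block (suc m)) k (0# ∷ v) ≡ 0# ∷ T^ (block m) k v
  shift-0∷ zero v = refl
  shift-0∷ (suc k) v = shift-0∷ k (shift 0# v)

  block-nilpotent : ∀ {m k} → m ≤ k → (v : Vec F m) → T^ (block m) k v ≡ replicate m 0#
  block-nilpotent {k = zero} z≤n [] = refl
  block-nilpotent {k = suc k} z≤n [] = block-nilpotent {k = k} z≤n []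
  block-nilpotent {suc m} {suc k} (s≤s m≤k) (x ∷ v) = trans (shift-0∷ k (shift x v)) (cong (0# ∷_) (block-nilpotent m≤k _))

  -- In a nonincreasing list the first part bounds the others. The largest block therefore has
  -- homomorphisms `eval b` to every vector `b` of the remaining ones, which is the reason for
  -- keeping the blocks sorted.
  jordan-nilpotent : ∀ {k μ} → Part k μ → (v : Mod.V (jordan μ)) → T^ (jordan μ) k v ≡ Mod.𝟎 (jordan μ)
  jordan-nilpotent {k} [] tt = T^-𝟎 unit k
  jordan-nilpotent {k} {suc j ∷ μ} (j<k ∷ p) (v , w) = trans (T^-⊗ (block (suc j)) (jordan μ) k v w)
    (cong₂ _,_ (block-nilpotent j<k v) (jordan-nilpotent (Part-mono j<k p) w))

  -- For `x = 0#`: a vector with constant coefficient 0 is divisible by t. The last coordinate of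
  -- the quotient is arbitrary, and 0 is chosen.
  shift-surjective : ∀ {m} x (xs : Vec F m) → ∃ λ z → shift x z ≡ x ∷ xs
  shift-surjective x [] = (0# ∷ []) , refl
  shift-surjective x (y ∷ xs) with shift-surjective y xs
  ... | z , e = (y ∷ z) , cong (x ∷_) e

  -- Extending the smaller blocks can lengthen one of them beyond the block set aside, so that block
  -- has to be sorted in again.
  insert-block : ∀ {k ν} j → suc j ≤ k → Part k ν →
    ∃ λ ν′ → Part k ν′ × (sum ν′ ≡ suc j + sum ν) × (block (suc j) ⊗ jordan ν ≅ jordan ν′)
  insert-block j j<k [] = _ , (j<k ∷ []) , refl , ≅-refl
  insert-block {k} {suc i ∷ ν} j j<k (i<k ∷ p) with ≤-total (suc i) (suc j)
  ... | inj₁ i≤j = _ , (j<k ∷ (i≤j ∷ p)) , refl , ≅-refl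
  ... | inj₂ j≤i with insert-block j j≤i p
  ...   | ν′ , p′ , s , φ = (suc i ∷ ν′) , (i<k ∷ p′) ,
    trans (cong (suc i +_) s) (x∙yz≈y∙xz (suc i) (suc j) (sum ν)) ,
    ≅-trans ⊗-swap (⊗-congʳ φ)
    where open CommutativeSemigroupProperties +-commutativeSemigroup using (x∙yz≈y∙xz)

  -- If the component of a in the largest block is divisible by t, it can be sheared away; otherwise a
  -- generates together with e a block one larger, split off by the homomorphism eval b.
  Ext-jordan : ∀ {k μ} → Part k μ → (a : Mod.V (jordan μ)) →
    ∃ λ ν → Part (suc k) ν × (sum ν ≡ suc (sum μ)) × (Ext (jordan μ) a ≅ jordan ν)
  Ext-jordan [] tt = (1 ∷ []) , (s≤s z≤n ∷ []) , refl , Ext-unit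
  Ext-jordan {k} {suc j ∷ μ} (j<k ∷ p) (x ∷ xs , b) with x ≟ 0# | shift-surjective x xs
  ... | yes refl | z , e with Ext-jordan p b
  ...   | ν , pν , sν , φ with insert-block j (m≤n⇒m≤1+n j<k) (Part-mono (s≤s j<k) pν)
  ...     | ν′ , pν′ , sν′ , ψ = ν′ , pν′ ,
    trans sν′ (trans (cong (suc j +_) sν) (+-suc (suc j) (sum μ))) ,
    ≅-trans (Ext-shear {a = replicate _ 0# , b} (z , N.𝟎)
              (cong₂ _,_ (trans (sym e) (sym (Space.⊞-identityˡ (vecSpace _) _))) (sym (trans (cong (b N.⊞_) N.T-𝟎) (N.⊞-identityʳ b)))))
            (≅-trans (Ext-⊗ʳ {block (suc j)} {jordan μ} b) (≅-trans (⊗-congʳ φ) ψ))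
    where module N = Mod (jordan μ)
  Ext-jordan {k} {suc j ∷ μ} (j<k ∷ p) (x ∷ xs , b) | no x≢0 | _ with inverse x x≢0
  ... | x′ , xx′ with shift-surjective 0# (x′ •ᵛ xs)
  -- Scaling by the inverse of the constant coefficient `x` makes the first component 1 + t z, and
  -- the shear by `z` reduces it to `gen j`. The rest is `b′ = eval b′ (gen j)`, so `Ext-hom`
  -- removes it, and only the first block is extended.
  ...   | z , e = suc (suc j) ∷ μ , (s≤s j<k ∷ Part-mono (m≤n⇒m≤1+n ≤-refl) p) , refl , subst (λ a → Ext (jordan (suc j ∷ μ)) a ≅ jordan (suc (suc j) ∷ μ)) scaled
    (≅-trans (Ext-scale {M} {x} {x′} (x′ L.• a) xx′)
    (≅-trans (Ext-shear {M} {gen j , b′} (z , N.𝟎) (cong₂ _,_ head-eq (sym (trans (cong (b′ N.⊞_) N.T-𝟎) (N.⊞-identityʳ b′)))))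
    (≅-trans (subst (λ u → Ext M (gen j , u) ≅ Ext M (gen j , N.𝟎)) (eval-gen (jordan μ) {j} b′)
               (≅-sym (Ext-hom {block (suc j)} {jordan μ} (eval (jordan μ) b′) (eval-linear (jordan μ) b′)
                 (eval-T (jordan μ) b′ (jordan-nilpotent p b′)) (gen j))))
    (≅-trans (Ext-⊗ˡ {block (suc j)} {jordan μ} (gen j)) (⊗-congˡ (Ext-gen j))))))
    where
    M = jordan (suc j ∷ μ)
    module L = Mod M
    module N = Mod (jordan μ)
    a : L.V
    a = x ∷ xs , b
    b′ = x′ N.• b
    scaled : x L.• (x′ L.• a) ≡ a
    scaled = trans (sym (L.•-assoc x x′ a)) (trans (cong (L._• a) xx′) (L.•-identity a))
    head-eq : x′ •ᵛ (x ∷ xs) ≡ gen j ⊞ᵛ shift 0# z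
    head-eq = trans (cong₂ _∷_ (trans (K.*-comm x′ x) (trans xx′ (sym (K.+-identityʳ 1#)))) (sym (Space.⊞-identityˡ (vecSpace j) (x′ •ᵛ xs))))
                    (cong (gen j ⊞ᵛ_) (sym e))

-- Matrices as endomorphisms of row vectors

module MatrixModules (𝔽 : FiniteField) where
  open FiniteField 𝔽 using (0#; 1#) renaming (Carrier to F; _+_ to _+ᶠ_; _*_ to _*ᶠ_; -_ to -ᶠ_)
  open LinearAlgebra 𝔽 public

  module _ (S : Space) where
    open Space S

    lin : ∀ {m} → (Fin m → V) → Vec F m → V
    lin R [] = 𝟎
    lin R (x ∷ v) = x • R zero ⊞ lin (R ∘ suc) v

    lin-cong : ∀ {m} {R R′ : Fin m → V} → (∀ i → R i ≡ R′ i) → ∀ v → lin R v ≡ lin R′ v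
    lin-cong e [] = refl
    lin-cong e (x ∷ v) = cong₂ _⊞_ (cong (x •_) (e zero)) (lin-cong (e ∘ suc) v)

    lin-linear : ∀ {m} (R : Fin m → V) → IsLinear (vecSpace m) S (lin R)
    lin-linear R = record { ⊞-homo = homo₁ R ; •-homo = homo₂ R }
      where
      homo₁ : ∀ {m} (R : Fin m → V) (v w : Vec F m) → lin R (v ⊞ᵛ w) ≡ lin R v ⊞ lin R w
      homo₁ R [] [] = sym (⊞-identityʳ 𝟎)
      homo₁ R (x ∷ v) (y ∷ w) = trans (cong₂ _⊞_ (•-distribʳ x y _) (homo₁ (R ∘ suc) v w)) (⊞-medial _ _ _ _)
      homo₂ : ∀ {m} (R : Fin m → V) c (v : Vec F m) → lin R (c •ᵛ v) ≡ c • lin R v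
      homo₂ R c [] = sym (•-zeroʳ c)
      homo₂ R c (x ∷ v) = trans (cong₂ _⊞_ (•-assoc c x _) (homo₂ (R ∘ suc) c v)) (sym (•-distribˡ c _ _))

    basis : ∀ {m} → Fin m → Vec F m
    basis {suc m} zero = gen m
    basis (suc i) = 0# ∷ basis i

    lin-basis : ∀ {m} (R : Fin m → V) i → lin R (basis i) ≡ R i
    lin-basis {suc m} R zero = trans (cong₂ _⊞_ (•-identity _) (IsLinear.𝟎-homo (lin-linear (R ∘ suc)))) (⊞-identityʳ _)
    lin-basis R (suc i) = trans (cong₂ _⊞_ (•-zero _) (lin-basis (R ∘ suc) i)) (⊞-identityˡ _)

  lin-hom : ∀ {S S′ f} → IsLinear S S′ f → ∀ {m} (R : Fin m → Space.V S) v → f (lin S R v) ≡ lin S′ (f ∘ R) v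
  lin-hom l R [] = IsLinear.𝟎-homo l
  lin-hom {S′ = S′} l R (x ∷ v) = trans (IsLinear.⊞-homo l _ _) (cong₂ (Space._⊞_ S′) (IsLinear.•-homo l _ _) (lin-hom l (R ∘ suc) v))

  lin-0∷ : ∀ {m n} (R : Fin m → Vec F n) v → lin (vecSpace (suc n)) (λ i → 0# ∷ R i) v ≡ 0# ∷ lin (vecSpace n) R v
  lin-0∷ R [] = refl
  lin-0∷ {n = n} R (x ∷ v) = trans (cong (x •ᵛ (0# ∷ R zero) ⊞ᵛ_) (lin-0∷ (R ∘ suc) v))
    (cong (_∷ (x •ᵛ R zero ⊞ᵛ lin (vecSpace n) (R ∘ suc) v)) (trans (K.+-identityʳ _) (K.zeroʳ x)))

  -- Row vectors: act A v = v A.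
  act : ∀ {m n} → (Fin m → Fin n → F) → Vec F m → Vec F n
  act {n = n} A = lin (vecSpace n) (λ i → Vec.tabulate (A i))

  vec-ext : ∀ {m} {v w : Vec F m} → (∀ i → lookup v i ≡ lookup w i) → v ≡ w
  vec-ext {v = v} {w} e = trans (sym (Vec.tabulate∘lookup v)) (trans (Vec.tabulate-cong e) (Vec.tabulate∘lookup w))

  lin-vec-basis : ∀ {m} (v : Vec F m) → lin (vecSpace m) (basis (vecSpace m)) v ≡ v
  lin-vec-basis [] = refl
  lin-vec-basis {suc m} (x ∷ v) = trans (cong (x •ᵛ gen m ⊞ᵛ_) (trans (lin-0∷ (basis (vecSpace m)) v) (cong (0# ∷_) (lin-vec-basis v))))
    (cong₂ _∷_ (trans (K.+-identityʳ _) (K.*-identityʳ x))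
               (trans (cong (_⊞ᵛ v) (Space.•-zeroʳ (vecSpace m) x)) (Space.⊞-identityˡ (vecSpace m) v)))

  matMod : ∀ {n} → (Fin n → Fin n → F) → Mod
  matMod {n} A = record { space = vecSpace n ; T = act A ; T-linear = lin-linear (vecSpace n) _ }

  module _ {n : ℕ} where
    open Matrices 𝔽 n
    open MatrixAlgebra 𝔽 n

    lookup-lin : ∀ {m} (R : Fin m → Vec F n) v j → lookup (lin (vecSpace n) R v) j ≡ sumᶠ (λ k → lookup v k *ᶠ lookup (R k) j)
    lookup-lin R [] j = Vec.lookup-replicate j 0#
    lookup-lin R (x ∷ v) j = trans (Vec.lookup-zipWith _+ᶠ_ j (x •ᵛ R zero) (lin (vecSpace n) (R ∘ suc) v))
      (cong₂ _+ᶠ_ (Vec.lookup-map j (x *ᶠ_) (R zero)) (lookup-lin (R ∘ suc) v j))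

    lookup-act : (A : Mat) (v : Vec F n) (j : Fin n) → lookup (act A v) j ≡ sumᶠ (λ k → lookup v k *ᶠ A k j)
    lookup-act A v j = trans (lookup-lin _ v j) (sum-cong-≗ (λ k → cong (lookup v k *ᶠ_) (Vec.lookup∘tabulate (A k) j)))

    act-cong : ∀ {A B} → A ≈ B → ∀ v → act A v ≡ act B v
    act-cong e = lin-cong (vecSpace n) (λ i → Vec.tabulate-cong (e i))

    -- Row i of a matrix is the image of the basis vector i.
    act-injective : ∀ {A B} → (∀ v → act A v ≡ act B v) → A ≈ B
    act-injective {A} {B} e i j = begin
      A i j                     ≡⟨ Vec.lookup∘tabulate (A i) j ⟨
      lookup (Vec.tabulate (A i)) j ≡⟨ cong (λ v → lookup v j) (trans (sym (lin-basis _ _ i)) (trans (e (basis (vecSpace n) i)) (lin-basis _ _ i))) ⟩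
      lookup (Vec.tabulate (B i)) j ≡⟨ Vec.lookup∘tabulate (B i) j ⟩
      B i j                     ∎
      where open ≡-Reasoning

    act-I : ∀ v → act I v ≡ v
    act-I v = vec-ext (λ j → trans (lookup-act I v j) (sum-δʳ j (lookup v)))

    act-· : ∀ A B v → act (A · B) v ≡ act B (act A v)
    act-· A B v = trans (lin-cong (vecSpace n) (λ i → vec-ext (λ j → begin
        lookup (Vec.tabulate ((A · B) i)) j                 ≡⟨ Vec.lookup∘tabulate ((A · B) i) j ⟩
        (A · B) i j                                     ≡⟨ ·-entry A B i j ⟩
        sumᶠ (λ k → A i k *ᶠ B k j)                      ≡⟨ sum-cong-≗ (λ k → cong (_*ᶠ B k j) (sym (Vec.lookup∘tabulate (A i) k))) ⟩
        sumᶠ (λ k → lookup (Vec.tabulate (A i)) k *ᶠ B k j)  ≡⟨ lookup-act B (Vec.tabulate (A i)) j ⟨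
        lookup (act B (Vec.tabulate (A i))) j               ∎)) v)
      (sym (lin-hom (lin-linear (vecSpace n) _) _ v))
      where open ≡-Reasoning

    matOf : (Vec F n → Vec F n) → Mat
    matOf f i = lookup (f (basis (vecSpace n) i))

    act-matOf : ∀ {f} → IsLinear (vecSpace n) (vecSpace n) f → ∀ v → act (matOf f) v ≡ f v
    act-matOf {f} l v = trans (lin-cong (vecSpace n) (λ i → Vec.tabulate∘lookup _) v)
      (trans (sym (lin-hom l _ v)) (cong f (lin-vec-basis v)))

    -- Acting on row vectors reverses products, so commuting with T reads A g = g B for the matrix
    -- `g` of the isomorphism.
    ≅⇒similar : ∀ {A B} → matMod A ≅ matMod B → ∃ λ g → ∃ λ g′ → IsInverse g g′ × (A ≈ (g · B) · g′)
    ≅⇒similar {A} {B} φ = g , g′ , (gg′ , g′g) , M.sym (M.trans (M.*-congʳ {g′} (M.sym Ag)) (cancelʳ A gg′))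
      where
      open _≅_ φ renaming (module M to M₀; module N to N₀)
      from-linear = _≅_.to-linear (≅-sym φ)
      g = matOf to
      g′ = matOf from
      gg′ : g · g′ ≈ I
      gg′ = act-injective (λ v → trans (act-· g g′ v) (trans (act-matOf from-linear _)
        (trans (cong from (act-matOf to-linear v)) (trans (from-to v) (sym (act-I v))))))
      g′g : g′ · g ≈ I
      g′g = act-injective (λ v → trans (act-· g′ g v) (trans (act-matOf to-linear _)
        (trans (cong to (act-matOf from-linear v)) (trans (to-from v) (sym (act-I v))))))
      Ag : A · g ≈ g · B
      Ag = act-injective (λ v → trans (act-· A g v) (trans (act-matOf to-linear _)
        (trans (to-T v) (trans (cong (act B) (sym (act-matOf to-linear v))) (sym (act-· g B v))))))

    similar⇒≅ : ∀ {A B g g′} → IsInverse g g′ → A ≈ (g · B) · g′ → matMod A ≅ matMod B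
    similar⇒≅ {A} {B} {g} {g′} (gg′ , g′g) e = record
      { to = act g ; from = act g′ ; to-linear = lin-linear (vecSpace n) _
      ; to-T = λ v → trans (sym (act-· A g v)) (trans (act-cong Ag v) (act-· g B v))
      ; from-to = λ v → trans (sym (act-· g g′ v)) (trans (act-cong gg′ v) (act-I v))
      ; to-from = λ v → trans (sym (act-· g′ g v)) (trans (act-cong g′g v) (act-I v)) }
      where
      Ag : A · g ≈ g · B
      Ag = M.trans (M.*-congʳ e) (cancelʳ (g · B) g′g)

  -- The first basis vector extends the span of the others, which is invariant.
  upper-jordan : ∀ n (A : Fin n → Fin n → F) → (∀ i j → toℕ j ≤ toℕ i → A i j ≡ 0#) →
    ∃ λ ν → Part n ν × (sum ν ≡ n) × (matMod A ≅ jordan ν)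
  upper-jordan zero A A0 = [] , [] , refl , record
    { to = λ _ → tt ; from = λ _ → [] ; to-linear = record { ⊞-homo = λ _ _ → refl ; •-homo = λ _ _ → refl }
    ; to-T = λ _ → refl ; from-to = λ { [] → refl } ; to-from = λ _ → refl }
  upper-jordan (suc n) A A0 with upper-jordan n (λ i j → A (suc i) (suc j)) (λ i j j≤i → A0 (suc i) (suc j) (s≤s j≤i))
  ... | ν , pν , sν , φ with Ext-jordan pν (_≅_.to φ (Vec.tabulate (A zero ∘ suc)))
  ...   | ν′ , pν′ , sν′ , ψ = ν′ , pν′ , trans sν′ (cong suc sν) , ≅-trans decompose (≅-trans (Ext-cong φ _) ψ)
    where
    A′ : Fin n → Fin n → F
    A′ i j = A (suc i) (suc j)
    a = Vec.tabulate (A zero ∘ suc)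
    -- Column 0 of a strictly upper triangular matrix vanishes, so the image has leading coordinate
    -- 0; its tail collects `x` times the first row and the action of the minor `A′`.
    act-∷ : ∀ x v → act A (x ∷ v) ≡ 0# ∷ (x •ᵛ a ⊞ᵛ act A′ v)
    act-∷ x v = trans (cong₂ _⊞ᵛ_ (cong (λ c → x •ᵛ (c ∷ a)) (A0 zero zero z≤n))
        (trans (lin-cong (vecSpace (suc n)) (λ i → cong (_∷ Vec.tabulate (A′ i)) (A0 (suc i) zero z≤n)) v) (lin-0∷ _ v)))
      (cong (_∷ (x •ᵛ a ⊞ᵛ act A′ v)) (trans (K.+-identityʳ _) (K.zeroʳ x)))
    decompose : matMod A ≅ Ext (matMod A′) a
    decompose = record
      { to = Vec.uncons ; from = λ (x , v) → x ∷ v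
      ; to-linear = record { ⊞-homo = λ { (x ∷ v) (y ∷ w) → refl } ; •-homo = λ { c (x ∷ v) → refl } }
      ; to-T = λ { (x ∷ v) → cong Vec.uncons (act-∷ x v) }
      ; from-to = λ { (x ∷ v) → refl } ; to-from = λ _ → refl }

  -- The shape of `J μ` with the search for block ends abstracted to `c`: the entry from coordinate
  -- i to i+1 is deleted where `c i` holds. An arbitrary `c` can be shifted in inductions.
  superdiag : (ℕ → Bool) → ∀ {n} → Fin n → Fin n → F
  superdiag c i j = if ⌊ toℕ j ℕ.≟ suc (toℕ i) ⌋ ∧ not (c (toℕ i)) then 1# else 0#

  -- The scalar `x` is the coordinate just before the vector, and `c 0` tells whether the step out
  -- of that coordinate is cut.
  shift-cut : ∀ {m} → (ℕ → Bool) → F → Vec F m → Vec F m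
  shift-cut c x [] = []
  shift-cut c x (y ∷ v) = (if c 0 then 0# else x) ∷ shift-cut (c ∘ suc) y v

  superdiag-suc : ∀ c {n} (i j : Fin n) → superdiag c (suc i) (suc j) ≡ superdiag (c ∘ suc) i j
  superdiag-suc c i j = cong (λ b → if b ∧ not (c (suc (toℕ i))) then 1# else 0#)
    (trans (isYes≗does _) (sym (isYes≗does (toℕ j ℕ.≟ suc (toℕ i)))))

  act-superdiag : ∀ c {m} x (v : Vec F m) → act (superdiag c) (x ∷ v) ≡ 0# ∷ shift-cut c x v
  act-superdiag c {zero} x [] = cong (_∷ []) (trans (K.+-identityʳ _) (K.zeroʳ x))
  act-superdiag c {suc m} x (y ∷ v) = begin
    act (superdiag c) (x ∷ y ∷ v)
      ≡⟨ cong (x •ᵛ Vec.tabulate (superdiag c {suc (suc m)} zero) ⊞ᵛ_) (lin-cong (vecSpace (suc (suc m)))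
           (λ i → cong (0# ∷_) (Vec.tabulate-cong (superdiag-suc c i))) (y ∷ v)) ⟩
    x •ᵛ Vec.tabulate (superdiag c {suc (suc m)} zero) ⊞ᵛ lin (vecSpace (suc (suc m))) (λ i → 0# ∷ Vec.tabulate (superdiag (c ∘ suc) i)) (y ∷ v)
      ≡⟨ cong₂ _⊞ᵛ_ (cong (λ r → x •ᵛ (0# ∷ (if not (c 0) then 1# else 0#) ∷ r)) (tabulate-0 m))
                    (trans (lin-0∷ (λ i → Vec.tabulate (superdiag (c ∘ suc) i)) (y ∷ v)) (cong (0# ∷_) (act-superdiag (c ∘ suc) y v))) ⟩
    x *ᶠ 0# +ᶠ 0# ∷ x *ᶠ (if not (c 0) then 1# else 0#) +ᶠ 0# ∷ (x •ᵛ replicate m 0#) ⊞ᵛ shift-cut (c ∘ suc) y v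
      ≡⟨ cong₂ _∷_ (trans (K.+-identityʳ _) (K.zeroʳ x)) (cong₂ _∷_ (trans (K.+-identityʳ _) (pick (c 0)))
           (trans (cong (_⊞ᵛ shift-cut (c ∘ suc) y v) (Space.•-zeroʳ (vecSpace m) x)) (Space.⊞-identityˡ (vecSpace m) _))) ⟩
    0# ∷ (if c 0 then 0# else x) ∷ shift-cut (c ∘ suc) y v ∎
    where
    open ≡-Reasoning
    tabulate-0 : ∀ m → Vec.tabulate {n = m} (λ _ → 0#) ≡ replicate m 0#
    tabulate-0 zero = refl
    tabulate-0 (suc m) = cong (0# ∷_) (tabulate-0 m)
    pick : ∀ b → x *ᶠ (if not b then 1# else 0#) ≡ (if b then 0# else x)
    pick true = K.zeroʳ x
    pick false = K.*-identityʳ x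

  -- c i says that coordinate i is the last one of its block.
  data Ends : List ℕ → (ℕ → Bool) → Set where
    []  : ∀ {c} → Ends [] c
    ends : ∀ {j μ c} → (∀ i → i < j → c i ≡ false) → c j ≡ true → Ends μ (λ i → c (suc j + i)) → Ends (suc j ∷ μ) c

  flatten : ∀ μ → Mod.V (jordan μ) → Vec F (sum μ)
  flatten [] tt = []
  flatten (m ∷ μ) (v , w) = v ++ flatten μ w

  unflatten : ∀ μ → Vec F (sum μ) → Mod.V (jordan μ)
  unflatten [] _ = tt
  unflatten (m ∷ μ) u = Vec.take m u , unflatten μ (Vec.drop m u)

  ends-jordan : ∀ {μ c} → Ends μ c → jordan μ ≅ matMod {sum μ} (superdiag c)
  ends-jordan {μ} {c} e = record
    { to = flatten μ ; from = unflatten μ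
    ; to-linear = record { ⊞-homo = homo₁ μ ; •-homo = homo₂ μ }
    ; to-T = comm e ; from-to = from-to μ ; to-from = to-from μ }
    where
    ⊞-++ : ∀ {m l} (v w : Vec F m) (v′ w′ : Vec F l) → (v ⊞ᵛ w) ++ (v′ ⊞ᵛ w′) ≡ (v ++ v′) ⊞ᵛ (w ++ w′)
    ⊞-++ [] [] v′ w′ = refl
    ⊞-++ (x ∷ v) (y ∷ w) v′ w′ = cong (x +ᶠ y ∷_) (⊞-++ v w v′ w′)
    homo₁ : ∀ μ v w → flatten μ (Mod._⊞_ (jordan μ) v w) ≡ flatten μ v ⊞ᵛ flatten μ w
    homo₁ [] _ _ = refl
    homo₁ (m ∷ μ) (v , v′) (w , w′) = trans (cong (v ⊞ᵛ w ++_) (homo₁ μ v′ w′)) (⊞-++ v w (flatten μ v′) (flatten μ w′))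
    homo₂ : ∀ μ c v → flatten μ (Mod._•_ (jordan μ) c v) ≡ c •ᵛ flatten μ v
    homo₂ [] _ _ = refl
    homo₂ (m ∷ μ) c (v , w) = trans (cong (c •ᵛ v ++_) (homo₂ μ c w)) (sym (Vec.map-++ (c *ᶠ_) v (flatten μ w)))
    from-to : ∀ μ v → unflatten μ (flatten μ v) ≡ v
    from-to [] tt = refl
    from-to (m ∷ μ) (v , w) = cong₂ _,_ (Vec.++-injectiveˡ _ v (Vec.take++drop≡id m (v ++ flatten μ w)))
      (trans (cong (unflatten μ) (Vec.++-injectiveʳ _ v (Vec.take++drop≡id m (v ++ flatten μ w)))) (from-to μ w))
    to-from : ∀ μ u → flatten μ (unflatten μ u) ≡ u
    to-from [] [] = refl
    to-from (m ∷ μ) u = trans (cong (Vec.take m u ++_) (to-from μ (Vec.drop m u))) (Vec.take++drop≡id m u)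
    -- The first block is `x` followed by `v`, so its last coordinate has index j. The cut there
    -- lets `y`, the start of the next block, receive 0.
    cut-++ : ∀ {j l} c x (v : Vec F j) (y : F) (w : Vec F l) → (∀ i → i < j → c i ≡ false) → c j ≡ true →
      shift-cut c x (v ++ y ∷ w) ≡ shift x v ++ 0# ∷ shift-cut (λ i → c (suc j + i)) y w
    cut-++ c x [] y w f t rewrite t = refl
    cut-++ c x (z ∷ v) y w f t rewrite f 0 (s≤s z≤n) = cong (x ∷_) (cut-++ (c ∘ suc) z v y w (λ i i<j → f (suc i) (s≤s i<j)) t)
    cut-[] : ∀ {j} c x (v : Vec F j) (w : Vec F 0) → (∀ i → i < j → c i ≡ false) → shift-cut c x (v ++ w) ≡ shift x v ++ w
    cut-[] c x [] [] f = refl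
    cut-[] c x (z ∷ v) w f rewrite f 0 (s≤s z≤n) = cong (x ∷_) (cut-[] (c ∘ suc) z v w (λ i i<j → f (suc i) (s≤s i<j)))
    cut : ∀ {j l} c x (v : Vec F j) (w : Vec F l) → (∀ i → i < j → c i ≡ false) → c j ≡ true →
      shift-cut c x (v ++ w) ≡ shift x v ++ act (superdiag (λ i → c (suc j + i))) w
    cut c x v [] f t = cut-[] c x v [] f
    cut c x v (y ∷ w) f t = trans (cut-++ c x v y w f t) (cong (shift x v ++_) (sym (act-superdiag _ y w)))
    comm : ∀ {μ c} → Ends μ c → ∀ v → flatten μ (Mod.T (jordan μ) v) ≡ act (superdiag c) (flatten μ v)
    comm [] tt = refl
    comm {suc j ∷ μ} {c} (ends f t e) (x ∷ v , w) = trans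
      (cong (0# ∷_) (trans (cong (shift x v ++_) (comm e w)) (sym (cut c x v (flatten μ w) f t))))
      (sym (act-superdiag c x (v ++ flatten μ w)))

  Ends-resp : ∀ {μ c d} → (∀ i → c i ≡ d i) → Ends μ c → Ends μ d
  Ends-resp e [] = []
  Ends-resp e (ends f t r) = ends (λ i i<j → trans (sym (e i)) (f i i<j)) (trans (sym (e _)) t) (Ends-resp (λ i → e _) r)

  module _ (n : ℕ) where
    open Matrices 𝔽 n

    partialSums-≥ : ∀ μ acc → All (acc ≤_) (partialSums μ acc)
    partialSums-≥ [] acc = []
    partialSums-≥ (m ∷ μ) acc = m≤m+n acc m ∷ All.map (≤-trans (m≤n+m acc m)) (partialSums-≥ μ (m + acc))

    not-in : ∀ {x acc} xs → x < acc → All (acc ≤_) xs → any (λ s → ⌊ s ℕ.≟ x ⌋) xs ≡ false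
    not-in [] x<a [] = refl
    not-in {x} (y ∷ xs) x<a (a≤y ∷ as) with y ℕ.≟ x
    ... | yes refl = contradiction (<-≤-trans x<a a≤y) (<-irrefl refl)
    ... | no _ = not-in xs x<a as

    -- Coordinates count from 0 and partial sums from 1: coordinate acc + i ends a block exactly
    -- when acc + i + 1 is a partial sum. Before the end of the first block all sums are too large;
    -- after it the first sum is too small, and the offset advances.
    partialSums-Ends : ∀ {k μ} → Part k μ → ∀ acc → Ends μ (λ i → any (λ s → ⌊ s ℕ.≟ suc (acc + i) ⌋) (partialSums μ acc))
    partialSums-Ends [] acc = []
    partialSums-Ends {μ = suc j ∷ μ} (_ ∷ p) acc = ends before at (Ends-resp after (partialSums-Ends p (suc j + acc)))
      where
      rest = partialSums μ (suc j + acc)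
      before : ∀ i → i < j → any (λ s → ⌊ s ℕ.≟ suc (acc + i) ⌋) (acc + suc j ∷ rest) ≡ false
      before i i<j = not-in _ (≤-reflexive refl) (lt₁ ∷ All.map (≤-trans lt₂) (partialSums-≥ μ _))
        where
        lt₁ : suc (suc (acc + i)) ≤ acc + suc j
        lt₁ = subst (suc (suc (acc + i)) ≤_) (sym (+-suc acc j)) (s≤s (subst (_≤ acc + j) (+-suc acc i) (+-monoʳ-≤ acc i<j)))
        lt₂ : suc (suc (acc + i)) ≤ suc j + acc
        lt₂ = subst (suc (suc (acc + i)) ≤_) (+-comm acc (suc j)) lt₁
      at : any (λ s → ⌊ s ℕ.≟ suc (acc + j) ⌋) (acc + suc j ∷ rest) ≡ true
      at with acc + suc j ℕ.≟ suc (acc + j)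
      ... | yes _ = refl
      ... | no ne = contradiction (+-suc acc j) ne
      after : ∀ i → any (λ s → ⌊ s ℕ.≟ suc (suc j + acc + i) ⌋) rest ≡
                    any (λ s → ⌊ s ℕ.≟ suc (acc + (suc j + i)) ⌋) (acc + suc j ∷ rest)
      after i with acc + suc j ℕ.≟ suc (acc + (suc j + i))
      ... | yes e = contradiction e (<⇒≢ (s≤s (+-monoʳ-≤ acc (m≤m+n (suc j) i))))
      ... | no _ = cong (λ x → any (λ s → ⌊ s ℕ.≟ suc x ⌋) rest)
                     (trans (cong (ℕ._+ i) (+-comm (suc j) acc)) (+-assoc acc (suc j) i))

  jordan-J : ∀ {n k μ} → Part k μ → sum μ ≡ n → matMod (Matrices.J 𝔽 n μ) ≅ jordan μ
  jordan-J {n} p refl = ≅-sym (ends-jordan (partialSums-Ends n p 0))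

-- Uniqueness of the Jordan type

∑-product : {A B : Set} (xs : List A) (ys : List B) (f : A → ℕ) (g : B → ℕ) →
  ∑ (concatMap (λ a → map (a ,_) ys) xs) (λ (a , b) → f a * g b) ≡ ∑ xs f * ∑ ys g
∑-product xs ys f g = begin
  ∑ (concatMap (λ a → map (a ,_) ys) xs) (λ (a , b) → f a * g b) ≡⟨ ∑-concatMap _ xs _ ⟩
  ∑ xs (λ a → ∑ (map (a ,_) ys) (λ (a , b) → f a * g b))         ≡⟨ ∑-cong xs (λ a → ∑-map (a ,_) ys _) ⟩
  ∑ xs (λ a → ∑ ys (λ b → f a * g b))                            ≡⟨ ∑-cong xs (λ a → ∑-*ˡ ys (f a) g) ⟩
  ∑ xs (λ a → f a * ∑ ys g)                                      ≡⟨ ∑-*ʳ xs (∑ ys g) f ⟩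
  ∑ xs f * ∑ ys g                                                ∎
  where open ≡-Reasoning

_×ᵉ_ : {A B : Set} → Enumeration {A} _≡_ → Enumeration {B} _≡_ → Enumeration {A × B} _≡_
E ×ᵉ E′ = record
  { list = concatMap (λ a → map (a ,_) E′.list) E.list
  ; eqᵇ = λ (a , b) (c , d) → E.eqᵇ a c ∧ E′.eqᵇ b d
  ; eq-reflects = λ (a , b) (c , d) → reflects-map (λ (e , f) → cong₂ _,_ e f) (λ e → cong proj₁ e , cong proj₂ e)
                                        (E.eq-reflects a c ×-reflects E′.eq-reflects b d)
  ; once = λ (a , b) → trans (∑-cong (concatMap (λ a → map (a ,_) E′.list) E.list) (λ (c , d) → 𝟙-∧ (E.eqᵇ a c) (E′.eqᵇ b d)))
      (trans (∑-product E.list E′.list _ _) (cong₂ _*_ (E.once a) (E′.once b))) }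
  where
  module E = Enumeration E
  module E′ = Enumeration E′

transport : {A B : Set} (f : A → B) (g : B → A) → (∀ b → f (g b) ≡ b) → (∀ a → g (f a) ≡ a) →
            Enumeration {A} _≡_ → Enumeration {B} _≡_
transport f g fg gf E = record
  { list = map f list
  ; eqᵇ = λ b b′ → eqᵇ (g b) (g b′)
  ; eq-reflects = λ b b′ → reflects-map (λ e → trans (sym (fg b)) (trans (cong f e) (fg b′))) (cong g) (eq-reflects (g b) (g b′))
  ; once = λ b → trans (∑-map f list _) (trans (∑-cong list (λ a → cong (𝟙 ∘ eqᵇ (g b)) (gf a))) (once (g b))) }
  where open Enumeration E


-- The part number k + 1 of the conjugate partition.
excess : ℕ → List ℕ → ℕ
excess k μ = ∑ μ (λ m → 𝟙 ⌊ k <? m ⌋)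

excess-Part : ∀ {k μ} → Part k μ → excess k μ ≡ 0
excess-Part [] = refl
excess-Part {k} {suc j ∷ μ} (j<k ∷ p) with k <? suc j
... | yes k<j = contradiction (<-≤-trans k<j j<k) (<-irrefl refl)
... | no _ = excess-Part (Part-mono j<k p)

-- The largest part is the least k with excess 0, so the first parts agree; their contributions then
-- cancel and leave the same question for the tails.
excess-injective : ∀ {k l μ ν} → Part k μ → Part l ν → (∀ k → excess k μ ≡ excess k ν) → μ ≡ ν
excess-injective [] [] e = refl
excess-injective [] (_ ∷ q) e = contradiction (e 0) λ ()
excess-injective (_ ∷ p) [] e = contradiction (e 0) λ ()
excess-injective {μ = suc i ∷ μ} {suc j ∷ ν} (_ ∷ p) (_ ∷ q) e with <-cmp i j
... | tri< i<j _ _ = contradiction (trans (sym (excess-Part (≤-refl ∷ p))) (e (suc i))) pos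
  where
  pos : 0 ≢ excess (suc i) (suc j ∷ ν)
  pos h with suc i <? suc j | h
  ... | yes _ | ()
  ... | no ¬h | _ = ¬h (s≤s i<j)
... | tri> _ _ j<i = contradiction (trans (sym (excess-Part (≤-refl ∷ q))) (sym (e (suc j)))) pos
  where
  pos : 0 ≢ excess (suc j) (suc i ∷ μ)
  pos h with suc j <? suc i | h
  ... | yes _ | ()
  ... | no ¬h | _ = ¬h (s≤s j<i)
... | tri≈ _ refl _ = cong (suc i ∷_) (excess-injective p q (λ k → +-cancelˡ-≡ (𝟙 ⌊ k <? suc i ⌋) _ _ (e k)))

-- In terms of kernels: passing from T^k to T^(k+1) gains one dimension for each block longer than
-- k.
∑-⊓-suc : ∀ k μ → ∑ μ (_⊓ suc k) ≡ ∑ μ (_⊓ k) + excess k μ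
∑-⊓-suc k μ = trans (∑-cong μ step) (∑-+ μ (_⊓ k) (λ m → 𝟙 ⌊ k <? m ⌋))
  where
  step : ∀ m → m ⊓ suc k ≡ m ⊓ k + 𝟙 ⌊ k <? m ⌋
  step m with k <? m
  ... | yes k<m = trans (m≥n⇒m⊓n≡n k<m) (trans (+-comm 1 k) (cong (_+ 1) (sym (m≥n⇒m⊓n≡n (<⇒≤ k<m)))))
  ... | no k≮m = trans (m≤n⇒m⊓n≡m (m≤n⇒m≤1+n (≮⇒≥ k≮m))) (trans (sym (m≤n⇒m⊓n≡m (≮⇒≥ k≮m))) (sym (+-identityʳ _)))

module JordanType (𝔽 : FiniteField) where
  open FiniteField 𝔽 using (0#; 0≢1; q; elements; complete) renaming (Carrier to F)
  open MatrixModules 𝔽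
  open ≡-Reasoning

  2≤q : 2 ≤ q
  2≤q with elements | complete
  ... | [] | c with c 0#
  ...   | ()
  2≤q | x ∷ [] | c with c 0# | c (FiniteField.1# 𝔽)
  ...   | here e | here e′ = contradiction (trans e (sym e′)) 0≢1
  2≤q | x ∷ y ∷ xs | c = s≤s (s≤s z≤n)

  -- This replaces dimension theory: the kernels are only counted, and since 0 and 1 are distinct, q
  -- is at least 2 and the order of a kernel determines the exponent.
  q^-injective : ∀ m n → q ^ m ≡ q ^ n → m ≡ n
  q^-injective m n e with <-cmp m n
  ... | tri< m<n _ _ = contradiction e (<⇒≢ (^-monoʳ-< q 2≤q m<n))
  ... | tri≈ _ m≡n _ = m≡n
  ... | tri> _ _ n<m = contradiction (sym e) (<⇒≢ (^-monoʳ-< q 2≤q n<m))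

  end : ∀ {m} → F → Vec F m → F
  end x [] = x
  end x (y ∷ v) = end y v

  -- `shift x v` is `x ∷ v` without its last coordinate, so T of a vector is 0 in front of the first
  -- component of `unsnoc`.
  unsnoc : ∀ {m} → Vec F (suc m) → Vec F m × F
  unsnoc (x ∷ v) = shift x v , end x v

  snoc-unsnoc : ∀ {m} (v : Vec F (suc m)) → proj₁ (unsnoc v) ∷ʳ proj₂ (unsnoc v) ≡ v
  snoc-unsnoc (x ∷ []) = refl
  snoc-unsnoc (x ∷ y ∷ v) = cong (x ∷_) (snoc-unsnoc (y ∷ v))

  unsnoc-snoc : ∀ {m} (v : Vec F m) z → unsnoc (v ∷ʳ z) ≡ (v , z)
  unsnoc-snoc [] z = refl
  unsnoc-snoc (x ∷ []) z = refl
  unsnoc-snoc (x ∷ y ∷ v) z = cong (λ (w , z) → x ∷ w , z) (unsnoc-snoc (y ∷ v) z)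

  -- The last coordinate is split off because T forgets it, so that kernels of powers of T can be counted by induction.
  blockEnumeration : ∀ m → Enumeration {Vec F m} _≡_
  blockEnumeration zero = record { list = [] ∷ [] ; eqᵇ = λ _ _ → true ; eq-reflects = λ { [] [] → ofʸ refl } ; once = λ _ → refl }
  blockEnumeration (suc m) = transport (λ (v , z) → v ∷ʳ z) unsnoc snoc-unsnoc (λ (v , z) → unsnoc-snoc v z)
    (blockEnumeration m ×ᵉ fieldEnumeration 𝔽)

  jordanEnumeration : ∀ μ → Enumeration {Mod.V (jordan μ)} _≡_
  jordanEnumeration [] = record { list = tt ∷ [] ; eqᵇ = λ _ _ → true ; eq-reflects = λ _ _ → ofʸ refl ; once = λ _ → refl }
  jordanEnumeration (m ∷ μ) = blockEnumeration m ×ᵉ jordanEnumeration μ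

  kernelSize : (M : Mod) → Enumeration {Mod.V M} _≡_ → ℕ → ℕ
  kernelSize M E k = ∑ list (λ v → 𝟙 (eqᵇ (T^ M k v) (Mod.𝟎 M)))
    where open Enumeration E

  kernelSize-≅ : ∀ {M N} (φ : M ≅ N) E E′ k → kernelSize M E k ≡ kernelSize N E′ k
  kernelSize-≅ {M} {N} φ E E′ k = sym (trans
    (∑-reindex E E′ (λ { refl → refl }) to from (λ { a b refl → from-to a }) (λ { a b refl → to-from b }))
    (∑-cong (Enumeration.list E) (λ v → cong 𝟙 (reflects-⇔ (Enumeration.eq-reflects E′ _ _) (Enumeration.eq-reflects E _ _)
      (λ e → trans (sym (from-to _)) (trans (cong from (trans (to-T^ k v) e)) from-𝟎))
      (λ e → trans (sym (to-T^ k v)) (trans (cong to e) to-𝟎))))))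
    where
    open _≅_ φ
    to-𝟎 = IsLinear.𝟎-homo to-linear
    from-𝟎 = IsLinear.𝟎-homo (_≅_.to-linear (≅-sym φ))
    to-T^ : ∀ k v → to (T^ M k v) ≡ T^ N k (to v)
    to-T^ zero v = refl
    to-T^ (suc k) v = trans (to-T^ k _) (cong (T^ N k) (to-T v))

  kernelSize-⊗ : ∀ {M N} E E′ k → kernelSize (M ⊗ N) (E ×ᵉ E′) k ≡ kernelSize M E k * kernelSize N E′ k
  kernelSize-⊗ {M} {N} E E′ k = trans
    (∑-cong (Enumeration.list (E ×ᵉ E′)) (λ (v , w) → trans (cong (λ u → 𝟙 (Enumeration.eqᵇ (E ×ᵉ E′) u (Mod.𝟎 M , Mod.𝟎 N))) (T^-⊗ M N k v w))
      (𝟙-∧ (Enumeration.eqᵇ E (T^ M k v) (Mod.𝟎 M)) (Enumeration.eqᵇ E′ (T^ N k w) (Mod.𝟎 N)))))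
    (∑-product (Enumeration.list E) (Enumeration.list E′)
      (λ v → 𝟙 (Enumeration.eqᵇ E (T^ M k v) (Mod.𝟎 M))) (λ w → 𝟙 (Enumeration.eqᵇ E′ (T^ N k w) (Mod.𝟎 N))))

  -- T forgets the last coordinate z and then acts on the rest v as the shorter block does: T^(k+1)
  -- kills the vector exactly when T^k kills v, while z is free and contributes a factor q.
  kernelSize-block : ∀ m k → kernelSize (block m) (blockEnumeration m) k ≡ q ^ (m ⊓ k)
  kernelSize-block zero k = refl
  kernelSize-block (suc m) zero = trans (∑-cong list flip) (once 𝟎ᵛ)
    where
    open Enumeration (blockEnumeration (suc m))
    flip : ∀ v → 𝟙 (eqᵇ v 𝟎ᵛ) ≡ 𝟙 (eqᵇ 𝟎ᵛ v)
    flip v = cong 𝟙 (reflects-⇔ (eq-reflects v 𝟎ᵛ) (eq-reflects 𝟎ᵛ v) sym sym)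
  kernelSize-block (suc m) (suc k) = begin
    ∑ (map snoc pairs) (λ v → 𝟙 (E′.eqᵇ (T^ (block (suc m)) (suc k) v) 𝟎ᵛ))
      ≡⟨ ∑-map snoc pairs _ ⟩
    ∑ pairs (λ (v , z) → 𝟙 (E′.eqᵇ (T^ (block (suc m)) (suc k) (v ∷ʳ z)) 𝟎ᵛ))
      ≡⟨ ∑-cong pairs (λ (v , z) → trans (cong 𝟙 (reflects-⇔ (E′.eq-reflects _ _) (E.eq-reflects (T^ (block m) k v) 𝟎ᵛ)
           (λ e → cong Vec.tail (trans (sym (T^-snoc v z)) e)) (λ e → trans (T^-snoc v z) (cong (0# ∷_) e)))) (sym (*-identityʳ _))) ⟩
    ∑ pairs (λ (v , z) → 𝟙 (E.eqᵇ (T^ (block m) k v) 𝟎ᵛ) * 1)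
      ≡⟨ ∑-product E.list elements _ (λ _ → 1) ⟩
    kernelSize (block m) (blockEnumeration m) k * ∑ elements (λ _ → 1)
      ≡⟨ cong₂ _*_ (kernelSize-block m k) (trans (∑-const elements 1) (*-identityʳ q)) ⟩
    q ^ (m ⊓ k) * q
      ≡⟨ *-comm _ q ⟩
    q ^ (suc m ⊓ suc k) ∎
    where
    module E = Enumeration (blockEnumeration m)
    module E′ = Enumeration (blockEnumeration (suc m))
    pairs = Enumeration.list (blockEnumeration m ×ᵉ fieldEnumeration 𝔽)
    snoc : Vec F m × F → Vec F (suc m)
    snoc (v , z) = v ∷ʳ z
    T-unsnoc : ∀ {m} (v : Vec F (suc m)) → shift 0# v ≡ 0# ∷ proj₁ (unsnoc v)
    T-unsnoc (x ∷ v) = refl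
    T^-snoc : ∀ v z → T^ (block (suc m)) (suc k) (v ∷ʳ z) ≡ 0# ∷ T^ (block m) k v
    T^-snoc v z = trans (cong (T^ (block (suc m)) k) (trans (T-unsnoc (v ∷ʳ z)) (cong (λ p → 0# ∷ proj₁ p) (unsnoc-snoc v z)))) (shift-0∷ k v)

  kernelSize-jordan : ∀ μ k → kernelSize (jordan μ) (jordanEnumeration μ) k ≡ q ^ ∑ μ (_⊓ k)
  kernelSize-jordan [] k = refl
  kernelSize-jordan (m ∷ μ) k = trans (kernelSize-⊗ {block m} {jordan μ} (blockEnumeration m) (jordanEnumeration μ) k)
    (trans (cong₂ _*_ (kernelSize-block m k) (kernelSize-jordan μ k)) (sym (^-distribˡ-+-* q (m ⊓ k) _)))

  jordan-injective : ∀ {k l μ ν} → Part k μ → Part l ν → jordan μ ≅ jordan ν → μ ≡ ν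
  jordan-injective {μ = μ} {ν} p p′ φ = excess-injective p p′ (λ k →
    +-cancelˡ-≡ (∑ μ (_⊓ k)) _ _ (trans (sym (∑-⊓-suc k μ)) (trans (same (suc k)) (trans (∑-⊓-suc k ν) (cong (_+ excess k ν) (sym (same k)))))))
    where
    same : ∀ k → ∑ μ (_⊓ k) ≡ ∑ ν (_⊓ k)
    same k = q^-injective _ _ (trans (sym (kernelSize-jordan μ k))
      (trans (kernelSize-≅ φ (jordanEnumeration μ) (jordanEnumeration ν) k) (kernelSize-jordan ν k)))

-- The enumeration of partitions

_≟ˡ_ = ≡-dec ℕ._≟_

partsF-sound : ∀ f n k → n ≤ f → All (λ μ → Part k μ × sum μ ≡ n) (partsF f n k)
partsF-sound f zero k _ = ([] , refl) ∷ []
partsF-sound (suc f) (suc n) k (s≤s n≤f) = All.concat⁺ (All.map⁺ (All.applyUpTo⁺₁ id (k ⊓ suc n) (λ {j} j< →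
  All.map⁺ (All.map (λ (p , s) → ≤-trans j< (m⊓n≤m k (suc n)) ∷ p ,
                                 trans (cong (suc j +_) s) (m+[n∸m]≡n (≤-trans j< (m⊓n≤n k (suc n)))))
    (partsF-sound f (n ∸ j) (suc j) (≤-trans (m∸n≤m n j) n≤f))))))

∑-upTo-once : ∀ {i} N → i < N → (f : ℕ → ℕ) → f i ≡ 1 → ∑ (upTo N) (λ j → 𝟙 ⌊ i ℕ.≟ j ⌋ * f j) ≡ 1
∑-upTo-once {i} N i<N f fi = trans (∑-cong (upTo N) (λ j → 𝟙-guard (⌊⌋-reflects (i ℕ.≟ j)) (λ { refl → fi })))
  (trans (∑-*ʳ (upTo N) 1 _) (trans (*-identityʳ _) (go N i<N id (λ e → e) {refl})))
  where
  none : ∀ N (g : ℕ → ℕ) → (∀ j → i ≢ g j) → ∑ (applyUpTo g N) (λ j → 𝟙 ⌊ i ℕ.≟ j ⌋) ≡ 0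
  none zero g h = refl
  none (suc N) g h with i ℕ.≟ g 0
  ... | yes e = contradiction e (h 0)
  ... | no _ = none N (g ∘ suc) (h ∘ suc)
  -- `applyUpTo` recurses by composing its function with `suc`, so `id` is generalized to an
  -- injective `g`.
  go : ∀ {x} N → x < N → (g : ℕ → ℕ) → (∀ {a b} → g a ≡ g b → a ≡ b) → {g x ≡ i} → ∑ (applyUpTo g N) (λ j → 𝟙 ⌊ i ℕ.≟ j ⌋) ≡ 1
  go {zero} (suc N) _ g inj {e} with i ℕ.≟ g 0
  ... | yes _ = cong suc (none N (g ∘ suc) (λ j e′ → 0≢1+n (inj (trans e e′))))
  ... | no ne = contradiction (sym e) ne
  go {suc x} (suc N) (s≤s x<N) g inj {e} with i ℕ.≟ g 0
  ... | yes e′ = contradiction (inj (trans e e′)) λ ()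
  ... | no _ = go N x<N (g ∘ suc) (λ e → suc-injective (inj e)) {e}

-- Only the branch whose first part is that of μ contributes. It lies in range because the first
-- part is bounded both by k and by the sum.
partsF-once : ∀ f n {k μ} → n ≤ f → Part k μ → sum μ ≡ n → ∑ (partsF f n k) (λ ν → 𝟙 ⌊ μ ≟ˡ ν ⌋) ≡ 1
partsF-once f zero _ [] _ = refl
partsF-once (suc f) (suc n) {k} {suc i ∷ μ} (s≤s n≤f) (i<k ∷ p) s = begin
  ∑ (concatMap (λ j → map (suc j ∷_) (rest j)) (upTo (k ⊓ suc n))) F
    ≡⟨ ∑-concatMap _ (upTo (k ⊓ suc n)) F ⟩
  ∑ (upTo (k ⊓ suc n)) (λ j → ∑ (map (suc j ∷_) (rest j)) F)
    ≡⟨ ∑-cong (upTo (k ⊓ suc n)) (λ j → trans (∑-map (suc j ∷_) (rest j) F) (trans (∑-cong (rest j) (λ ν → cons j ν)) (∑-*ˡ (rest j) (𝟙 ⌊ i ℕ.≟ j ⌋) (λ ν → 𝟙 ⌊ μ ≟ˡ ν ⌋)))) ⟩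
  ∑ (upTo (k ⊓ suc n)) (λ j → 𝟙 ⌊ i ℕ.≟ j ⌋ * ∑ (rest j) (λ ν → 𝟙 ⌊ μ ≟ˡ ν ⌋))
    ≡⟨ ∑-upTo-once (k ⊓ suc n) (⊓-glb i<k (≤-trans (m≤m+n (suc i) (sum μ)) (≤-reflexive s)))
         (λ j → ∑ (rest j) (λ ν → 𝟙 ⌊ μ ≟ˡ ν ⌋))
         (partsF-once f (n ∸ i) (≤-trans (m∸n≤m n i) n≤f) p (sym (trans (cong (_∸ i) (sym (suc-injective s))) (m+n∸m≡n i (sum μ))))) ⟩
  1 ∎
  where
  open ≡-Reasoning
  rest : ℕ → List (List ℕ)
  rest j = partsF f (suc n ∸ suc j) (suc j)
  F : List ℕ → ℕ
  F ν = 𝟙 ⌊ (suc i ∷ μ) ≟ˡ ν ⌋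
  cons : ∀ j ν → 𝟙 ⌊ (suc i ∷ μ) ≟ˡ (suc j ∷ ν) ⌋ ≡ 𝟙 ⌊ i ℕ.≟ j ⌋ * 𝟙 ⌊ μ ≟ˡ ν ⌋
  cons j ν = trans (cong 𝟙 (reflects-⇔ (⌊⌋-reflects ((suc i ∷ μ) ≟ˡ (suc j ∷ ν))) (⌊⌋-reflects (i ℕ.≟ j) ×-reflects ⌊⌋-reflects (μ ≟ˡ ν))
    (λ { refl → refl , refl }) (λ { (refl , refl) → refl }))) (𝟙-∧ ⌊ i ℕ.≟ j ⌋ ⌊ μ ≟ˡ ν ⌋)

-- Double cosets

-- Turns a search through the group into a search through all matrices with membership as a
-- conjunct, to which `any-reflects` applies.
any-map-filterᵇ : {A B : Set} (p : B → Bool) (f : A → B) (r : A → Bool) (xs : List A) →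
  any p (map f (filterᵇ r xs)) ≡ any (λ x → r x ∧ p (f x)) xs
any-map-filterᵇ p f r [] = refl
any-map-filterᵇ p f r (x ∷ xs) with r x
... | true  = cong (p (f x) ∨_) (any-map-filterᵇ p f r xs)
... | false = any-map-filterᵇ p f r xs

≤?-suc : ∀ a b → ⌊ suc a ℕ.≤? suc b ⌋ ≡ ⌊ a ℕ.≤? b ⌋
≤?-suc a b = reflects-⇔ (⌊⌋-reflects (suc a ℕ.≤? suc b)) (⌊⌋-reflects (a ℕ.≤? b)) (λ { (s≤s p) → p }) s≤s

product-powers : ∀ q k (e : Fin k → ℕ) → product (tabulate (λ i → q ^ e i)) ≡ q ^ sum (map e (allFin k))
product-powers q zero e = refl
product-powers q (suc k) e = begin
  q ^ e zero * product (tabulate (λ i → q ^ e (suc i)))  ≡⟨ cong (q ^ e zero *_) (product-powers q k (e ∘ suc)) ⟩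
  q ^ e zero * q ^ sum (map (e ∘ suc) (allFin k))        ≡⟨ ^-distribˡ-+-* q (e zero) _ ⟨
  q ^ (e zero + sum (map (e ∘ suc) (allFin k)))          ≡⟨ cong (q ^_) (foldr-allFin _+_ 0 e) ⟨
  q ^ sum (map e (allFin (suc k)))                       ∎
  where open ≡-Reasoning

-- The number of choices for one row of a matrix in 𝔲_h, where t is the 0-based value of h: columns
-- 0 to t are forced to be 0, the remaining n - (t + 1) are free.
product-above : ∀ q n t → product (tabulate {n = n} (λ j → if ⌊ toℕ j ℕ.≤? t ⌋ then 1 else q)) ≡ q ^ (n ∸ suc t)
product-above q zero t = refl
product-above q (suc n) zero = trans (+-identityʳ _) (trans (powers n (λ j → refl)) refl)
  where
  powers : ∀ k {f : Fin k → ℕ} → (∀ j → f j ≡ q) → product (tabulate f) ≡ q ^ k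
  powers zero e = refl
  powers (suc k) e = cong₂ _*_ (e zero) (powers k (e ∘ suc))
product-above q (suc n) (suc t) = trans (+-identityʳ _) (trans
  (cong product (tabulate-cong (λ (j : Fin n) → cong (λ b → if b then 1 else q) (≤?-suc (toℕ j) t))))
  (product-above q n t))

∑-const-allFin : ∀ k c → ∑ (allFin k) (λ _ → c) ≡ k * c
∑-const-allFin k c = trans (∑-const (allFin k) c) (cong (_* c) (length-tabulate (λ (i : Fin k) → i)))

complement-size : ∀ {n} (h : Hessenberg n) →
  ∑ (allFin n) (λ i → n ∸ suc (toℕ (Hessenberg.fun h i))) + size h ≡ n * n
complement-size {n} h = trans (sym (∑-+ (allFin n) _ _))
  (trans (∑-cong (allFin n) (λ i → m∸n+n≡m (toℕ<n (Hessenberg.fun h i)))) (∑-const-allFin n n))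

module DoubleCosets (𝔽 : FiniteField) (n : ℕ) where
  open FiniteField 𝔽 using (Carrier; 0#; 1#; _≟_; q; elements) renaming (_+_ to _+ᶠ_; _*_ to _*ᶠ_; -_ to -ᶠ_)
  open Matrices 𝔽 n
  open MatrixAlgebra 𝔽 n
  open MatrixModules 𝔽 using (_≅_; ≅-trans; ≅-sym; jordan; matMod; upper-jordan; jordan-J; ≅⇒similar; similar⇒≅)
  open JordanType 𝔽 using (jordan-injective)
  private module K = CommutativeRing (commutativeRing 𝔽)
  open Hessenberg

  -- The algebra 𝔲_h and the group I + 𝔲_h

  InLieU : Hessenberg n → Mat → Set
  InLieU h A = ∀ i j → toℕ j ≤ toℕ (fun h i) → A i j ≡ 0#

  inLieU-reflects : ∀ h A → Reflects (InLieU h A) (inLieU h A)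
  inLieU-reflects h A = all-reflects (λ i → all-reflects (λ j → entry i j))
    where
    entry : ∀ i j → Reflects (toℕ j ≤ toℕ (fun h i) → A i j ≡ 0#)
                             (if ⌊ toℕ j ℕ.≤? toℕ (fun h i) ⌋ then ⌊ A i j ≟ 0# ⌋ else true)
    entry i j with toℕ j ℕ.≤? toℕ (fun h i)
    ... | yes j≤ = reflects-map (λ e _ → e) (λ f → f j≤) (⌊⌋-reflects (A i j ≟ 0#))
    ... | no j≰  = ofʸ (λ j≤ → contradiction j≤ j≰)

  lieSize : Hessenberg n → ℕ
  lieSize h = ∑ allMats (λ A → 𝟙 (inLieU h A))

  lieSize≡ : ∀ h → lieSize h ≡ q ^ ∑ (allFin n) (λ i → n ∸ suc (toℕ (fun h i)))
  lieSize≡ h = begin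
    lieSize h
      ≡⟨ ∑-allVecs 𝔽 n (allVecs elements n) n _ ⟩
    product (tabulate (λ i → ∑ (allVecs elements n) (λ v → 𝟙 (all (λ j → if b i j then ⌊ v j ≟ 0# ⌋ else true) (allFin n)))))
      ≡⟨ cong product (tabulate-cong (λ i → trans (∑-allVecs 𝔽 n elements n _)
           (trans (cong product (tabulate-cong (λ j → entry (b i j)))) (product-above q n (toℕ (fun h i)))))) ⟩
    product (tabulate (λ i → q ^ (n ∸ suc (toℕ (fun h i)))))
      ≡⟨ product-powers q n _ ⟩
    q ^ ∑ (allFin n) (λ i → n ∸ suc (toℕ (fun h i))) ∎
    where
    open ≡-Reasoning
    b : Fin n → Fin n → Bool
    b i j = ⌊ toℕ j ℕ.≤? toℕ (fun h i) ⌋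
    entry : ∀ b → ∑ elements (λ a → 𝟙 (if b then ⌊ a ≟ 0# ⌋ else true)) ≡ (if b then 1 else q)
    entry true = trans (∑-cong elements (λ a → cong 𝟙 (reflects-⇔ (⌊⌋-reflects (a ≟ 0#)) (⌊⌋-reflects (0# ≟ a)) sym sym)))
      (Enumeration.once (fieldEnumeration 𝔽) 0#)
    entry false = trans (∑-const elements 1) (*-identityʳ q)

  InLieU-resp : ∀ {h A B} → A ≈ B → InLieU h A → InLieU h B
  InLieU-resp e a i j j≤ = trans (sym (e i j)) (a i j j≤)

  InLieU-O : ∀ h → InLieU h O
  InLieU-O h i j _ = refl

  InLieU-⊕ : ∀ {h A B} → InLieU h A → InLieU h B → InLieU h (A ⊕ B)
  InLieU-⊕ a b i j j≤ = trans (cong₂ _+ᶠ_ (a i j j≤) (b i j j≤)) (K.+-identityʳ 0#)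

  InLieU-⊖ : ∀ {h A} → InLieU h A → InLieU h (⊖ A)
  InLieU-⊖ a i j j≤ = trans (cong -ᶠ_ (a i j j≤)) (-0#≈0#)
    where open import Algebra.Properties.Ring K.ring using (-0#≈0#)

  -- In a term with k ≤ h(i) the first factor vanishes. Otherwise j ≤ h(i) < k ≤ h(k), and the
  -- second factor vanishes.
  InLieU-· : ∀ {h A B} → InLieU h A → InLieU h B → InLieU h (A · B)
  InLieU-· {h} {A} {B} a b i j j≤ = trans (·-entry A B i j) (sum-zero _ (λ k → term k (<-≤-connex (toℕ (fun h i)) (toℕ k))))
    where
    open import Data.Sum using (_⊎_; inj₁; inj₂)
    term : ∀ k → toℕ (fun h i) < toℕ k ⊎ toℕ k ≤ toℕ (fun h i) → A i k *ᶠ B k j ≡ 0#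
    term k (inj₁ hi<k) = trans (cong (A i k *ᶠ_) (b k j (≤-trans j≤ (≤-trans (<⇒≤ hi<k) (extensive h k))))) (K.zeroʳ _)
    term k (inj₂ k≤hi) = trans (cong (_*ᶠ B k j) (a i k k≤hi)) (K.zeroˡ _)

  infixl 6 _⊚_
  -- The group law transported to 𝔲_h along `A ↦ I ⊕ A`, so that sums over the group can be sums
  -- over 𝔲_h.
  _⊚_ : Mat → Mat → Mat
  A ⊚ B = A ⊕ (B ⊕ (A · B))

  ⊚-homo : ∀ A B → I ⊕ (A ⊚ B) ≈ (I ⊕ A) · (I ⊕ B)
  ⊚-homo A B = begin
    I ⊕ (A ⊕ (B ⊕ (A · B)))              ≈⟨ M.+-assoc I A (B ⊕ (A · B)) ⟨
    (I ⊕ A) ⊕ (B ⊕ (A · B))              ≈⟨ M.+-congˡ {I ⊕ A} (M.+-congʳ {A · B} (M.*-identityˡ B)) ⟨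
    (I ⊕ A) ⊕ ((I · B) ⊕ (A · B))        ≈⟨ M.+-cong (M.*-identityʳ (I ⊕ A)) (M.distribʳ B I A) ⟨
    ((I ⊕ A) · I) ⊕ ((I ⊕ A) · B)        ≈⟨ M.distribˡ (I ⊕ A) I B ⟨
    (I ⊕ A) · (I ⊕ B)                    ∎
    where open import Relation.Binary.Reasoning.Setoid M.setoid

  InLieU-⊚ : ∀ {h A B} → InLieU h A → InLieU h B → InLieU h (A ⊚ B)
  InLieU-⊚ {h} {A} {B} a b = InLieU-⊕ {h} {A} a (InLieU-⊕ {h} {B} b (InLieU-· {h} {A} {B} a b))

  -- Partial sums of the geometric series for (I + A)⁻¹ - I.
  geometric : Mat → ℕ → Mat
  geometric A zero = O
  geometric A (suc k) = ⊖ (A ⊕ (A · geometric A k))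

  quasiInverse : Mat → Mat
  quasiInverse A = geometric A n

  InLieU-geometric : ∀ {h A} → InLieU h A → ∀ k → InLieU h (geometric A k)
  InLieU-geometric {h} a zero = InLieU-O h
  InLieU-geometric {h} {A} a (suc k) = InLieU-⊖ {h} {A ⊕ (A · geometric A k)}
    (InLieU-⊕ {h} {A} a (InLieU-· {h} {A} a (InLieU-geometric {h} {A} a k)))

  InLieU-quasiInverse : ∀ {h A} → InLieU h A → InLieU h (quasiInverse A)
  InLieU-quasiInverse {h} {A} a = InLieU-geometric {h} {A} a n

  -- Consecutive partial sums differ by a power A^(k+1) up to sign, which vanishes for j ≤ i + k. In
  -- the induction only l > i contributes, and this turns the bound i + k + 1 into l + k.
  geometric-stable : ∀ {A} → (∀ i j → toℕ j ≤ toℕ i → A i j ≡ 0#) →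
    ∀ k i j → toℕ j ≤ toℕ i + k → geometric A k i j ≡ geometric A (suc k) i j
  geometric-stable {A} a zero i j j≤ = sym (trans (cong -ᶠ_ (trans (cong₂ _+ᶠ_ (a i j (subst (toℕ j ≤_) (+-identityʳ _) j≤)) (M.zeroʳ A i j)) (K.+-identityʳ 0#))) -0#≈0#)
    where open import Algebra.Properties.Ring K.ring using (-0#≈0#)
  geometric-stable {A} a (suc k) i j j≤ = cong -ᶠ_ (cong (A i j +ᶠ_)
    (trans (·-entry A (geometric A k) i j) (trans (sum-cong-≗ term) (sym (·-entry A (geometric A (suc k)) i j)))))
    where
    term : ∀ l → A i l *ᶠ geometric A k l j ≡ A i l *ᶠ geometric A (suc k) l j
    term l with toℕ l ℕ.≤? toℕ i
    ... | yes l≤i = trans (cong (_*ᶠ geometric A k l j) (a i l l≤i)) (trans (K.zeroˡ _)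
                      (sym (trans (cong (_*ᶠ geometric A (suc k) l j) (a i l l≤i)) (K.zeroˡ _))))
    ... | no l≰i = cong (A i l *ᶠ_) (geometric-stable a k l j
                     (≤-trans j≤ (≤-trans (≤-reflexive (+-suc (toℕ i) k)) (+-monoˡ-≤ k (≰⇒> l≰i)))))

  InLieU⇒strict : ∀ h {A} → InLieU h A → ∀ i j → toℕ j ≤ toℕ i → A i j ≡ 0#
  InLieU⇒strict h a i j j≤i = a i j (≤-trans j≤i (extensive h i))

  right-inverse : ∀ h {A} → InLieU h A → (I ⊕ A) · (I ⊕ quasiInverse A) ≈ I
  right-inverse h {A} a = begin
    (I ⊕ A) · (I ⊕ X)       ≈⟨ ⊚-homo A X ⟨
    I ⊕ (A ⊕ (X ⊕ (A · X))) ≈⟨ M.+-congˡ {I} (x∙yz≈y∙xz A X (A · X)) ⟩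
    -- Column indices are below n, so after n steps every entry is stable and X = -(A + A X).
    I ⊕ (X ⊕ (A ⊕ (A · X))) ≈⟨ M.+-congˡ {I} (M.+-congʳ {A ⊕ (A · X)} (λ i j → geometric-stable (InLieU⇒strict h {A} a) n i j
                                 (≤-trans (<⇒≤ (toℕ<n j)) (m≤n+m n (toℕ i))))) ⟩
    I ⊕ ((⊖ (A ⊕ (A · X))) ⊕ (A ⊕ (A · X))) ≈⟨ M.+-congˡ {I} (M.-‿inverseˡ (A ⊕ (A · X))) ⟩
    I ⊕ O                   ≈⟨ M.+-identityʳ I ⟩
    I                       ∎
    where
    open import Relation.Binary.Reasoning.Setoid M.setoid
    open import Algebra.Properties.CommutativeSemigroup M.+-commutativeSemigroup using (x∙yz≈y∙xz)
    X = quasiInverse A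

  inverse-unique : ∀ {a b c} → b · a ≈ I → a · c ≈ I → b ≈ c
  inverse-unique {a} {b} {c} ba ac = M.trans (M.sym (M.*-identityʳ b)) (M.trans (M.*-congˡ {b} (M.sym ac)) (cancelˡ c ba))

  -- The right inverse lies in the same group and hence has a right inverse too; that one must be
  -- `I ⊕ A`, which makes the first inverse two-sided.
  unipotent-inverse : ∀ h {A} → InLieU h A → IsInverse (I ⊕ A) (I ⊕ quasiInverse A)
  unipotent-inverse h {A} a = right , M.trans (M.*-congˡ {I ⊕ X} (inverse-unique right right′)) right′
    where
    X = quasiInverse A
    right = right-inverse h {A} a
    right′ = right-inverse h {X} (InLieU-quasiInverse {h} {A} a)

  ⊕-cancel : ∀ {A B} → I ⊕ A ≈ I ⊕ B → A ≈ B
  ⊕-cancel {A} {B} = +-cancelˡ I A B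

  -- Sums over the unipotent and general linear groups

  ∑U : Hessenberg n → (Mat → ℕ) → ℕ
  ∑U h f = ∑ allMats (λ A → 𝟙 (inLieU h A) * f A)

  ∑U-cong : ∀ h {f g} → (∀ A → InLieU h A → f A ≡ g A) → ∑U h f ≡ ∑U h g
  ∑U-cong h e = ∑-cong allMats (λ A → 𝟙-guard (inLieU-reflects h A) (e A))

  ∑U-translateˡ : ∀ h {A₀} → InLieU h A₀ → ∀ {f} → (∀ {A B} → A ≈ B → f A ≡ f B) → ∑U h f ≡ ∑U h (λ A → f (A₀ ⊚ A))
  ∑U-translateˡ h {A₀} a₀ f-cong = ∑-reindex-on matEnumeration matEnumeration f-cong (inLieU-reflects h) (inLieU-reflects h)
    (A₀ ⊚_) (quasiInverse A₀ ⊚_)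
    (λ A B a e → InLieU-resp {h} e (InLieU-⊚ {h} {A₀} {A} a₀ a) , move (proj₂ inv) e)
    (λ A B b e → InLieU-resp {h} e (InLieU-⊚ {h} {quasiInverse A₀} {B} (InLieU-quasiInverse {h} {A₀} a₀) b) , move (proj₁ inv) e)
    where
    inv = unipotent-inverse h {A₀} a₀
    move : ∀ {A X B C} → (I ⊕ X) · (I ⊕ A) ≈ I → A ⊚ B ≈ C → X ⊚ C ≈ B
    move {A} {X} {B} {C} xa e = ⊕-cancel (M.trans (⊚-homo X C) (M.trans (M.*-congˡ {I ⊕ X}
      (M.trans (M.+-congˡ {I} (M.sym e)) (⊚-homo A B))) (cancelˡ (I ⊕ B) xa)))

  ∑U-translateʳ : ∀ h {A₀} → InLieU h A₀ → ∀ {f} → (∀ {A B} → A ≈ B → f A ≡ f B) → ∑U h f ≡ ∑U h (λ A → f (A ⊚ A₀))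
  ∑U-translateʳ h {A₀} a₀ f-cong = ∑-reindex-on matEnumeration matEnumeration f-cong (inLieU-reflects h) (inLieU-reflects h)
    (_⊚ A₀) (_⊚ quasiInverse A₀)
    (λ A B a e → InLieU-resp {h} e (InLieU-⊚ {h} {A} {A₀} a a₀) , move (proj₁ inv) e)
    (λ A B b e → InLieU-resp {h} e (InLieU-⊚ {h} {B} {quasiInverse A₀} b (InLieU-quasiInverse {h} {A₀} a₀)) , move (proj₂ inv) e)
    where
    inv = unipotent-inverse h {A₀} a₀
    move : ∀ {A X B C} → (I ⊕ A) · (I ⊕ X) ≈ I → B ⊚ A ≈ C → C ⊚ X ≈ B
    move {A} {X} {B} {C} ax e = ⊕-cancel (M.trans (⊚-homo C X) (M.trans (M.*-congʳ {I ⊕ X}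
      (M.trans (M.+-congˡ {I} (M.sym e)) (⊚-homo B A))) (cancelʳ (I ⊕ B) ax)))

  ∑U-inverse : ∀ h {f} → (∀ {A B} → A ≈ B → f A ≡ f B) → ∑U h f ≡ ∑U h (f ∘ quasiInverse)
  ∑U-inverse h f-cong = ∑-reindex-on matEnumeration matEnumeration f-cong (inLieU-reflects h) (inLieU-reflects h)
    quasiInverse quasiInverse flip (λ A B → flip B A)
    where
    flip : ∀ A B → InLieU h A → quasiInverse A ≈ B → InLieU h B × (quasiInverse B ≈ A)
    flip A B a e = b , ⊕-cancel (M.sym (inverse-unique
        (M.trans (M.*-congˡ {I ⊕ A} (M.+-congˡ {I} (M.sym e))) (proj₁ (unipotent-inverse h {A} a)))
        (proj₁ (unipotent-inverse h {B} b))))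
      where b = InLieU-resp {h} e (InLieU-quasiInverse {h} {A} a)

  infix 8 _⟪_⟫_
  -- The right factor multiplies without an inverse, as in `sameDoubleCoset`. The inversion that the
  -- fixed-point equation u₁ g = g u₂ asks for is supplied by `∑U-inverse`.
  _⟪_⟫_ : Mat → Mat → Mat → Mat
  A ⟪ x ⟫ B = ((I ⊕ A) · x) · (I ⊕ B)

  ⟪⟫-cong : ∀ {A A′ x x′ B B′} → A ≈ A′ → x ≈ x′ → B ≈ B′ → A ⟪ x ⟫ B ≈ A′ ⟪ x′ ⟫ B′
  ⟪⟫-cong a x b = M.*-cong (M.*-cong (M.+-congˡ {I} a) x) (M.+-congˡ {I} b)

  ⟪⟫-⊚ : ∀ A A₀ x B₀ B → (A ⊚ A₀) ⟪ x ⟫ (B₀ ⊚ B) ≈ A ⟪ A₀ ⟪ x ⟫ B₀ ⟫ B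
  ⟪⟫-⊚ A A₀ x B₀ B = begin
    ((I ⊕ (A ⊚ A₀)) · x) · (I ⊕ (B₀ ⊚ B))    ≈⟨ M.*-cong (M.*-congʳ {x} (⊚-homo A A₀)) (⊚-homo B₀ B) ⟩
    ((a · a₀) · x) · (b₀ · b)                 ≈⟨ M.*-assoc ((a · a₀) · x) b₀ b ⟨
    (((a · a₀) · x) · b₀) · b                 ≈⟨ M.*-congʳ {b} (M.trans (M.*-congʳ {b₀} (M.*-assoc a a₀ x)) (M.*-assoc a (a₀ · x) b₀)) ⟩
    (a · ((a₀ · x) · b₀)) · b                 ∎
    where
    open import Relation.Binary.Reasoning.Setoid M.setoid
    a = I ⊕ A
    a₀ = I ⊕ A₀
    b₀ = I ⊕ B₀
    b = I ⊕ B

  ∑G : (Mat → ℕ) → ℕ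
  ∑G f = ∑ allMats (λ g → 𝟙 (isInvertible g) * f g)

  ∑U-∑G-swap : ∀ h (f : Mat → Mat → ℕ) → ∑G (λ g → ∑U h (f g)) ≡ ∑U h (λ A → ∑G (λ g → f g A))
  ∑U-∑G-swap h f = begin
    ∑G (λ g → ∑U h (f g))
      ≡⟨ ∑-cong allMats (λ g → sym (∑-*ˡ allMats (𝟙 (isInvertible g)) _)) ⟩
    ∑ allMats (λ g → ∑ allMats (λ A → 𝟙 (isInvertible g) * (𝟙 (inLieU h A) * f g A)))
      ≡⟨ ∑-swap allMats allMats _ ⟩
    ∑ allMats (λ A → ∑ allMats (λ g → 𝟙 (isInvertible g) * (𝟙 (inLieU h A) * f g A)))
      ≡⟨ ∑-cong allMats (λ A → trans (∑-cong allMats (λ g → x∙yz≈y∙xz (𝟙 (isInvertible g)) (𝟙 (inLieU h A)) (f g A))) (∑-*ˡ allMats (𝟙 (inLieU h A)) _)) ⟩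
    ∑U h (λ A → ∑G (λ g → f g A)) ∎
    where
    open ≡-Reasoning
    open import Algebra.Properties.CommutativeSemigroup *-commutativeSemigroup using (x∙yz≈y∙xz)

  -- The number of invertible intertwiners. The terms g cancel in (I + A) g = g (I + B), so it also
  -- counts the g with u₁ g = g u₂.
  fixing : Mat → Mat → ℕ
  fixing A B = ∑G (λ g → 𝟙 ((A · g) == (g · B)))

  InClass : List ℕ → Mat → Set
  InClass μ A = ∃ λ g → ∃ λ g′ → (g · g′ ≈ I) × (g′ · g ≈ I) × (A ≈ (g′ · J μ) · g)

  inClass-reflects : ∀ μ A → Reflects (InClass μ A) (inClass μ A)
  inClass-reflects μ A = any-reflects
    (λ e (g′ , a , b , c) → g′ , M.trans (M.*-congʳ {g′} (M.sym e)) a , M.trans (M.*-congˡ {g′} (M.sym e)) b , M.trans c (M.*-congˡ {g′ · J μ} e))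
    (λ g → any-reflects
      (λ e (a , b , c) → M.trans (M.*-congˡ {g} (M.sym e)) a , M.trans (M.*-congʳ {g} (M.sym e)) b , M.trans c (M.*-congʳ {g} (M.*-congʳ {J μ} e)))
      (λ g′ → ==-reflects (g · g′) I ×-reflects ==-reflects (g′ · g) I ×-reflects ==-reflects A ((g′ · J μ) · g)))
    where open Enumeration matEnumeration using (any-reflects)

  Fcount-∑ : ∀ μ h → Fcount μ h ≡ ∑U h (λ A → 𝟙 (inClass μ A))
  Fcount-∑ μ h = trans (count-∑ (inClass μ) (lieU h)) (∑-filterᵇ (inLieU h) allMats _)

  -- For A = p⁻¹ J p and B = r⁻¹ J r, the map c ↦ p⁻¹ c r sends centralizing elements to intertwining ones.
  fixing-class : ∀ μ {A B} → InClass μ A → InClass μ B → centralizerSize μ ≡ fixing A B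
  fixing-class μ {A} {B} (p , p′ , pp′ , p′p , eA) (r , r′ , rr′ , r′r , eB) = begin
    centralizerSize μ
      ≡⟨ trans (count-∑ _ GL) (∑-filterᵇ isInvertible allMats _) ⟩
    ∑G (λ c → 𝟙 ((c · (I ⊕ J μ)) == ((I ⊕ J μ) · c)))
      ≡⟨ ∑-cong allMats (λ c → cong (λ b → 𝟙 (isInvertible c) * 𝟙 b) (reflects-⇔ (==-reflects _ _) (==-reflects _ _) (to c) (from c))) ⟩
    ∑G (λ c → 𝟙 ((A · ((p′ · c) · r)) == (((p′ · c) · r) · B)))
      ≡⟨ ∑-reindex-on matEnumeration matEnumeration
           (λ e → cong 𝟙 (==-cong (M.*-congˡ {A} e) (M.*-congʳ {B} e)))
           isInvertible-reflects isInvertible-reflects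
           (λ c → (p′ · c) · r) (λ g → (p · g) · r′)
           (λ c g (c′ , ic) e → Invertible-resp e (_ , Inverse-· (Inverse-· (p′p , pp′) ic) (rr′ , r′r)) , undo pp′ rr′ e)
           (λ c g (g′ , ig) e → Invertible-resp e (_ , Inverse-· (Inverse-· (pp′ , p′p) ig) (r′r , rr′)) , undo p′p r′r e) ⟨
    fixing A B ∎
    where
    open ≡-Reasoning
    undo : ∀ {p p′ r r′ c g} → p · p′ ≈ I → r · r′ ≈ I → (p′ · c) · r ≈ g → (p · g) · r′ ≈ c
    undo {p} {p′} {r} {r′} {c} {g} pp′ rr′ e = M.trans (M.*-congʳ {r′} (M.*-congˡ {p} (M.trans (M.sym e) (M.*-assoc p′ c r))))
      (M.trans (M.*-congʳ {r′} (cancelˡ (c · r) pp′)) (cancelʳ c rr′))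
    left : ∀ c → A · ((p′ · c) · r) ≈ (p′ · (J μ · c)) · r
    left c = M.trans (M.*-cong eA (M.*-assoc p′ c r)) (M.trans (cancel-mid (p′ · J μ) (c · r) pp′)
      (M.trans (M.sym (M.*-assoc (p′ · J μ) c r)) (M.*-congʳ {r} (M.*-assoc p′ (J μ) c))))
    right : ∀ c → ((p′ · c) · r) · B ≈ (p′ · (c · J μ)) · r
    right c = M.trans (M.*-congˡ {(p′ · c) · r} (M.trans eB (M.*-assoc r′ (J μ) r))) (M.trans (cancel-mid (p′ · c) (J μ · r) rr′)
      (M.trans (M.sym (M.*-assoc (p′ · c) (J μ) r)) (M.*-congʳ {r} (M.*-assoc p′ c (J μ)))))
    to : ∀ c → c · (I ⊕ J μ) ≈ (I ⊕ J μ) · c → A · ((p′ · c) · r) ≈ ((p′ · c) · r) · B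
    to c e = M.trans (left c) (M.trans (M.*-congʳ {r} (M.*-congˡ {p′} (M.sym cJ))) (M.sym (right c)))
      where
      cJ : c · J μ ≈ J μ · c
      cJ = +-cancelˡ c (c · J μ) (J μ · c) (M.trans (M.+-congʳ {c · J μ} (M.sym (M.*-identityʳ c)))
        (M.trans (M.sym (M.distribˡ c I (J μ))) (M.trans e (M.trans (M.distribʳ c I (J μ)) (M.+-congʳ {J μ · c} (M.*-identityˡ c))))))
    from : ∀ c → A · ((p′ · c) · r) ≈ ((p′ · c) · r) · B → c · (I ⊕ J μ) ≈ (I ⊕ J μ) · c
    from c e = M.trans (M.distribˡ c I (J μ)) (M.trans (M.+-cong (M.trans (M.*-identityʳ c) (M.sym (M.*-identityˡ c))) (M.sym Jc)) (M.sym (M.distribʳ c I (J μ))))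
      where
      Jc : J μ · c ≈ c · J μ
      Jc = M.trans (M.sym (undo pp′ rr′ M.refl)) (M.trans (M.*-congʳ {r′} (M.*-congˡ {p} (M.trans (M.sym (left c)) (M.trans e (right c))))) (undo pp′ rr′ M.refl))

  -- An intertwiner g would give B = g⁻¹ A g and put B into the class of A, with conjugating matrix
  -- `p · g`.
  fixing-outside : ∀ μ {A B} → InClass μ A → ¬ InClass μ B → fixing A B ≡ 0
  fixing-outside μ {A} {B} (p , p′ , pp′ , p′p , eA) ¬B = trans
    (∑-cong allMats (λ g → trans (𝟙-guard (isInvertible-reflects g) (none g)) (*-zeroʳ (𝟙 (isInvertible g))))) (∑-zero allMats)
    where
    none : ∀ g → Invertible g → 𝟙 ((A · g) == (g · B)) ≡ 0
    none g (g′ , gg′ , g′g) with (A · g) == (g · B) | ==-reflects (A · g) (g · B)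
    ... | false | _ = refl
    ... | true | ofʸ e = contradiction (p · g , g′ · p′ , proj₁ inv , proj₂ inv , eB) ¬B
      where
      inv = Inverse-· (pp′ , p′p) (gg′ , g′g)
      open import Relation.Binary.Reasoning.Setoid M.setoid
      eB : B ≈ ((g′ · p′) · J μ) · (p · g)
      eB = begin
        B                                ≈⟨ cancelˡ B g′g ⟨
        g′ · (g · B)                     ≈⟨ M.*-congˡ {g′} e ⟨
        g′ · (A · g)                     ≈⟨ M.*-congˡ {g′} (M.*-congʳ {g} eA) ⟩
        g′ · (((p′ · J μ) · p) · g)      ≈⟨ M.*-congˡ {g′} (M.*-assoc (p′ · J μ) p g) ⟩
        g′ · ((p′ · J μ) · (p · g))      ≈⟨ M.*-assoc g′ (p′ · J μ) (p · g) ⟨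
        (g′ · (p′ · J μ)) · (p · g)      ≈⟨ M.*-congʳ {p · g} (M.*-assoc g′ p′ (J μ)) ⟨
        ((g′ · p′) · J μ) · (p · g)      ∎

  -- Once A has type μ, `fixing A B` already vanishes unless B has it too, so it absorbs the
  -- indicator for B. Afterwards μ occurs only in the indicator for A, which sums to 1 over all
  -- partitions.
  class-pair : ∀ μ A B → 𝟙 (inClass μ A) * (𝟙 (inClass μ B) * centralizerSize μ) ≡ 𝟙 (inClass μ A) * fixing A B
  class-pair μ A B = 𝟙-guard (inClass-reflects μ A) step
    where
    step : InClass μ A → 𝟙 (inClass μ B) * centralizerSize μ ≡ fixing A B
    step a with inClass μ B | inClass-reflects μ B
    ... | true  | ofʸ b  = trans (*-identityˡ _) (fixing-class μ a b)
    ... | false | ofⁿ ¬b = sym (fixing-outside μ a ¬b)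

  InClass⇔≅ : ∀ {k μ A} → Part k μ → sum μ ≡ n → (InClass μ A → matMod A ≅ jordan μ) × (matMod A ≅ jordan μ → InClass μ A)
  InClass⇔≅ {k} {μ} {A} p s =
    -- `InClass` has the inverse on the left of `J μ`, similarity has it on the right; hence g and
    -- g′ change places.
    (λ (g , g′ , gg′ , g′g , e) → ≅-trans (similar⇒≅ (g′g , gg′) e) (jordan-J p s)) ,
    (λ φ → case ≅⇒similar (≅-trans φ (≅-sym (jordan-J p s))) of λ (g , g′ , (gg′ , g′g) , e) → g′ , g , g′g , gg′ , e)

  -- On the listed partitions, lying in the class of μ amounts to μ = ν for the type ν found by
  -- `upper-jordan`, and ν is listed once.
  one-class : ∀ {h A} → InLieU h A → ∑ (partitions n) (λ μ → 𝟙 (inClass μ A)) ≡ 1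
  one-class {h} {A} a with upper-jordan n A (InLieU⇒strict h {A} a)
  ... | ν , pν , sν , φ = trans
    (∑-cong-All (All.map (λ {μ} (p , s) → cong 𝟙 (reflects-⇔ (inClass-reflects μ A) (⌊⌋-reflects (ν ≟ˡ μ))
      (λ c → jordan-injective pν p (≅-trans (≅-sym φ) (proj₁ (InClass⇔≅ p s) c)))
      (λ { refl → proj₂ (InClass⇔≅ p s) φ }))) (partsF-sound n n n ≤-refl)))
    (partsF-once n n ≤-refl pν sν)

  -- Burnside's lemma and the sum over Jordan types

  module _ (h₁ h₂ : Hessenberg n) where
    Same : Mat → Mat → Set
    Same x z = ∃ λ A → InLieU h₁ A × ∃ λ B → InLieU h₂ B × (A ⟪ x ⟫ B ≈ z)

    sameDoubleCoset-reflects : ∀ x z → Reflects (Same x z) (sameDoubleCoset h₁ h₂ x z)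
    sameDoubleCoset-reflects x z = subst (Reflects (Same x z))
      (sym (any-map-filterᵇ _ (I ⊕_) (inLieU h₁) allMats))
      (any-reflects (λ e (a , B , b , s) → InLieU-resp {h₁} e a , B , b , M.trans (⟪⟫-cong (M.sym e) M.refl M.refl) s)
        (λ A → inLieU-reflects h₁ A ×-reflects
          subst (Reflects _) (sym (any-map-filterᵇ _ (I ⊕_) (inLieU h₂) allMats))
            (any-reflects (λ e (b , s) → InLieU-resp {h₂} e b , M.trans (⟪⟫-cong {A} {A} {x} {x} M.refl M.refl (M.sym e)) s)
              (λ B → inLieU-reflects h₂ B ×-reflects ==-reflects (A ⟪ x ⟫ B) z))))
      where open Enumeration matEnumeration using (any-reflects)

    Same-refl : ∀ x → Same x x
    Same-refl x = O , InLieU-O h₁ , O , InLieU-O h₂ , M.trans (M.*-cong (M.*-congʳ {x} (M.+-identityʳ I)) (M.+-identityʳ I))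
      (M.trans (M.*-identityʳ (I · x)) (M.*-identityˡ x))

    Same-sym : ∀ x z → Same x z → Same z x
    Same-sym x z (A , a , B , b , e) = quasiInverse A , InLieU-quasiInverse {h₁} {A} a , quasiInverse B , InLieU-quasiInverse {h₂} {B} b , (begin
      (a′ · z) · b′                         ≈⟨ M.*-congʳ {b′} (M.*-congˡ {a′} (M.trans (M.sym e) (M.*-assoc (I ⊕ A) x (I ⊕ B)))) ⟩
      (a′ · ((I ⊕ A) · (x · (I ⊕ B)))) · b′ ≈⟨ M.*-congʳ {b′} (cancelˡ (x · (I ⊕ B)) (proj₂ (unipotent-inverse h₁ {A} a))) ⟩
      (x · (I ⊕ B)) · b′                    ≈⟨ cancelʳ x (proj₁ (unipotent-inverse h₂ {B} b)) ⟩
      x                                     ∎)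
      where
      open import Relation.Binary.Reasoning.Setoid M.setoid
      a′ = I ⊕ quasiInverse A
      b′ = I ⊕ quasiInverse B

    Same-trans : ∀ x y z → Same x y → Same y z → Same x z
    Same-trans x y z (A , a , B , b , e) (A′ , a′ , B′ , b′ , e′) =
      A′ ⊚ A , InLieU-⊚ {h₁} {A′} {A} a′ a , B ⊚ B′ , InLieU-⊚ {h₂} {B} {B′} b b′ ,
      M.trans (⟪⟫-⊚ A′ A x B B′) (M.trans (⟪⟫-cong {A′} {A′} M.refl e M.refl) e′)

    transporters : Mat → Mat → ℕ
    transporters x z = ∑U h₁ (λ A → ∑U h₂ (λ B → 𝟙 ((A ⟪ x ⟫ B) == z)))

    stabilizer : Mat → ℕ
    stabilizer z = transporters z z

    -- Translating by one pair that carries x to z matches the pairs that carry x to z with those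
    -- that fix z. If there is no such pair, both sides are 0.
    transporters-Same : ∀ x z → 𝟙 (sameDoubleCoset h₁ h₂ x z) * stabilizer z ≡ transporters x z
    transporters-Same x z with sameDoubleCoset h₁ h₂ x z | sameDoubleCoset-reflects x z
    ... | true | ofʸ (A₀ , a₀ , B₀ , b₀ , e) = trans (*-identityˡ _) (sym (begin
      ∑U h₁ (λ A → ∑U h₂ (λ B → 𝟙 ((A ⟪ x ⟫ B) == z)))
        ≡⟨ ∑U-translateʳ h₁ {A₀} a₀ (λ a → ∑U-cong h₂ (λ B _ → cong 𝟙 (==-cong (⟪⟫-cong a M.refl M.refl) M.refl))) ⟩
      ∑U h₁ (λ A → ∑U h₂ (λ B → 𝟙 (((A ⊚ A₀) ⟪ x ⟫ B) == z)))
        ≡⟨ ∑U-cong h₁ (λ A _ → ∑U-translateˡ h₂ {B₀} b₀ (λ b → cong 𝟙 (==-cong (⟪⟫-cong {A ⊚ A₀} {A ⊚ A₀} {x} {x} M.refl M.refl b) M.refl))) ⟩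
      ∑U h₁ (λ A → ∑U h₂ (λ B → 𝟙 (((A ⊚ A₀) ⟪ x ⟫ (B₀ ⊚ B)) == z)))
        ≡⟨ ∑U-cong h₁ (λ A _ → ∑U-cong h₂ (λ B _ → cong 𝟙 (==-cong
             (M.trans (⟪⟫-⊚ A A₀ x B₀ B) (⟪⟫-cong {A} {A} M.refl e M.refl)) M.refl))) ⟩
      stabilizer z ∎))
      where open ≡-Reasoning
    ... | false | ofⁿ ¬s = sym (trans (∑U-cong h₁ (λ A a → trans (∑U-cong h₂ (λ B b → zero-at A a B b)) (zeros h₂))) (zeros h₁))
      where
      zeros : ∀ h → ∑U h (λ _ → 0) ≡ 0
      zeros h = trans (∑-cong allMats (λ A → *-zeroʳ (𝟙 (inLieU h A)))) (∑-zero allMats)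
      zero-at : ∀ A → InLieU h₁ A → ∀ B → InLieU h₂ B → 𝟙 ((A ⟪ x ⟫ B) == z) ≡ 0
      zero-at A a B b with (A ⟪ x ⟫ B) == z | ==-reflects (A ⟪ x ⟫ B) z
      ... | true  | ofʸ e = contradiction (A , a , B , b , e) ¬s
      ... | false | _     = refl

    -- After exchanging the sums, each pair of group elements carries x to exactly one invertible
    -- matrix.
    ∑G-transporters : ∀ x → Invertible x → ∑G (transporters x) ≡ lieSize h₁ * lieSize h₂
    ∑G-transporters x x-inv = begin
      ∑G (transporters x)
        ≡⟨ ∑U-∑G-swap h₁ _ ⟩
      ∑U h₁ (λ A → ∑G (λ z → ∑U h₂ (λ B → 𝟙 ((A ⟪ x ⟫ B) == z))))
        ≡⟨ ∑U-cong h₁ (λ A _ → ∑U-∑G-swap h₂ _) ⟩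
      ∑U h₁ (λ A → ∑U h₂ (λ B → ∑G (λ z → 𝟙 ((A ⟪ x ⟫ B) == z))))
        ≡⟨ ∑U-cong h₁ (λ A a → ∑U-cong h₂ (λ B b → one A a B b)) ⟩
      ∑U h₁ (λ A → ∑U h₂ (λ B → 1))
        ≡⟨ ∑-*ʳ allMats (∑U h₂ (λ B → 1)) _ ⟩
      lieSize h₁ * ∑U h₂ (λ B → 1)
        ≡⟨ cong (lieSize h₁ *_) (∑-cong allMats (λ B → *-identityʳ _)) ⟩
      lieSize h₁ * lieSize h₂ ∎
      where
      open ≡-Reasoning
      one : ∀ A → InLieU h₁ A → ∀ B → InLieU h₂ B → ∑G (λ z → 𝟙 ((A ⟪ x ⟫ B) == z)) ≡ 1
      one A a B b = trans (∑-cong allMats (λ z → *-comm (𝟙 (isInvertible z)) _))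
        (trans (Enumeration.∑-pick matEnumeration
                  (λ e → cong 𝟙 (reflects-⇔ (isInvertible-reflects _) (isInvertible-reflects _) (Invertible-resp e) (Invertible-resp (M.sym e))))
                  (A ⟪ x ⟫ B))
               (cong 𝟙 (reflects-true (isInvertible-reflects (A ⟪ x ⟫ B))
                 (_ , Inverse-· (Inverse-· (unipotent-inverse h₁ {A} a) (proj₂ x-inv)) (unipotent-inverse h₂ {B} b)))))

    burnside : doubleCosets h₁ h₂ * (lieSize h₁ * lieSize h₂) ≡ ∑U h₁ (λ A → ∑U h₂ (λ B → fixing A B))
    burnside = begin
      doubleCosets h₁ h₂ * (lieSize h₁ * lieSize h₂)
        ≡⟨ numClasses-∑ (sameDoubleCoset h₁ h₂)
             (λ x → reflects-true (sameDoubleCoset-reflects x x) (Same-refl x))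
             (λ x y e → reflects-true (sameDoubleCoset-reflects y x) (Same-sym x y (reflects-sound (sameDoubleCoset-reflects x y) e)))
             (λ x y z e e′ → reflects-true (sameDoubleCoset-reflects x z) (Same-trans x y z
               (reflects-sound (sameDoubleCoset-reflects x y) e) (reflects-sound (sameDoubleCoset-reflects y z) e′)))
             stabilizer (lieSize h₁ * lieSize h₂) GL
             -- Orbit-stabilizer: the stabilizer orders over the class of x add up to the number of
             -- all pairs.
             (All.map (λ {x} e → trans (∑-filterᵇ isInvertible allMats _)
                (trans (∑-cong allMats (λ z → cong (𝟙 (isInvertible z) *_) (transporters-Same x z)))
                       (∑G-transporters x (reflects-sound (isInvertible-reflects x) e))))
               (filterᵇ-All isInvertible allMats)) ⟩
      ∑ GL stabilizer
        ≡⟨ ∑-filterᵇ isInvertible allMats stabilizer ⟩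
      ∑G stabilizer
        ≡⟨ ∑U-∑G-swap h₁ _ ⟩
      ∑U h₁ (λ A → ∑G (λ g → ∑U h₂ (λ B → 𝟙 ((A ⟪ g ⟫ B) == g))))
        ≡⟨ ∑U-cong h₁ (λ A _ → ∑-cong allMats (λ g → cong (𝟙 (isInvertible g) *_) (intertwine A g))) ⟩
      ∑U h₁ (λ A → ∑G (λ g → ∑U h₂ (λ B → 𝟙 ((A · g) == (g · B)))))
        ≡⟨ ∑U-cong h₁ (λ A _ → ∑U-∑G-swap h₂ _) ⟩
      ∑U h₁ (λ A → ∑U h₂ (λ B → fixing A B)) ∎
      where
      open ≡-Reasoning
      -- Replacing u₂ by its inverse turns u₁ g u₂ = g into u₁ g = g u₂, which is the condition A g
      -- = g B.
      intertwine : ∀ A g → ∑U h₂ (λ B → 𝟙 ((A ⟪ g ⟫ B) == g)) ≡ ∑U h₂ (λ B → 𝟙 ((A · g) == (g · B)))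
      intertwine A g = trans
        (∑U-inverse h₂ (λ b → cong 𝟙 (==-cong (⟪⟫-cong {A} {A} {g} {g} M.refl M.refl b) M.refl)))
        (∑U-cong h₂ (λ B b → cong 𝟙 (reflects-⇔ (==-reflects (A ⟪ g ⟫ quasiInverse B) g) (==-reflects (A · g) (g · B))
          (λ e → to B (unipotent-inverse h₂ {B} b) e) (λ e → from B (unipotent-inverse h₂ {B} b) e))))
        where
        to : ∀ B {b′} → IsInverse (I ⊕ B) b′ → ((I ⊕ A) · g) · b′ ≈ g → A · g ≈ g · B
        to B {b′} (_ , b′b) e = +-cancelˡ g (A · g) (g · B) (M.trans
          (M.trans (M.+-congʳ {A · g} (M.sym (M.*-identityˡ g))) (M.sym (M.distribʳ g I A)))
          (M.trans (M.trans (M.sym (cancelʳ ((I ⊕ A) · g) b′b)) (M.*-congʳ {I ⊕ B} e))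
                   (M.trans (M.distribˡ g I B) (M.+-congʳ {g · B} (M.*-identityʳ g)))))
        from : ∀ B {b′} → IsInverse (I ⊕ B) b′ → A · g ≈ g · B → ((I ⊕ A) · g) · b′ ≈ g
        from B {b′} (bb′ , _) e = M.trans (M.*-congʳ {b′} (M.trans (M.distribʳ g I A)
          (M.trans (M.+-cong (M.trans (M.*-identityˡ g) (M.sym (M.*-identityʳ g))) e) (M.sym (M.distribˡ g I B))))) (cancelʳ g bb′)

    sum-over-classes : ∑ (partitions n) (λ μ → centralizerSize μ * Fcount μ h₁ * Fcount μ h₂) ≡ ∑U h₁ (λ A → ∑U h₂ (λ B → fixing A B))
    sum-over-classes = begin
      ∑ P (λ μ → centralizerSize μ * Fcount μ h₁ * Fcount μ h₂)
        ≡⟨ ∑-cong P expand ⟩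
      ∑ P (λ μ → ∑ allMats (λ A → ∑ allMats (λ B → 𝟙 (inLieU h₁ A) * (𝟙 (inLieU h₂ B) * (𝟙 (inClass μ A) * fixing A B)))))
        ≡⟨ trans (∑-swap P allMats _) (∑-cong allMats (λ A → ∑-swap P allMats _)) ⟩
      ∑ allMats (λ A → ∑ allMats (λ B → ∑ P (λ μ → 𝟙 (inLieU h₁ A) * (𝟙 (inLieU h₂ B) * (𝟙 (inClass μ A) * fixing A B)))))
        ≡⟨ ∑-cong allMats (λ A → ∑-cong allMats (λ B → collect A B)) ⟩
      ∑ allMats (λ A → ∑ allMats (λ B → 𝟙 (inLieU h₁ A) * (𝟙 (inLieU h₂ B) * fixing A B)))
        ≡⟨ ∑-cong allMats (λ A → ∑-*ˡ allMats (𝟙 (inLieU h₁ A)) _) ⟩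
      ∑U h₁ (λ A → ∑U h₂ (λ B → fixing A B)) ∎
      where
      open ≡-Reasoning
      P = partitions n
      expand : ∀ μ → centralizerSize μ * Fcount μ h₁ * Fcount μ h₂ ≡
        ∑ allMats (λ A → ∑ allMats (λ B → 𝟙 (inLieU h₁ A) * (𝟙 (inLieU h₂ B) * (𝟙 (inClass μ A) * fixing A B))))
      expand μ = begin
        Z * Fcount μ h₁ * Fcount μ h₂
          ≡⟨ cong₂ (λ x y → Z * x * y) (Fcount-∑ μ h₁) (Fcount-∑ μ h₂) ⟩
        Z * ∑U h₁ (λ A → 𝟙 (inClass μ A)) * ∑U h₂ (λ B → 𝟙 (inClass μ B))
          ≡⟨ cong (_* ∑U h₂ (λ B → 𝟙 (inClass μ B))) (sym (∑-*ˡ allMats Z _)) ⟩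
        ∑ allMats (λ A → Z * (𝟙 (inLieU h₁ A) * 𝟙 (inClass μ A))) * ∑U h₂ (λ B → 𝟙 (inClass μ B))
          ≡⟨ sym (∑-*ʳ allMats _ _) ⟩
        ∑ allMats (λ A → Z * (𝟙 (inLieU h₁ A) * 𝟙 (inClass μ A)) * ∑U h₂ (λ B → 𝟙 (inClass μ B)))
          ≡⟨ ∑-cong allMats (λ A → sym (∑-*ˡ allMats (Z * (𝟙 (inLieU h₁ A) * 𝟙 (inClass μ A))) (λ B → 𝟙 (inLieU h₂ B) * 𝟙 (inClass μ B)))) ⟩
        ∑ allMats (λ A → ∑ allMats (λ B → Z * (𝟙 (inLieU h₁ A) * 𝟙 (inClass μ A)) * (𝟙 (inLieU h₂ B) * 𝟙 (inClass μ B))))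
          ≡⟨ ∑-cong allMats (λ A → ∑-cong allMats (λ B → trans
               (rearrange Z (𝟙 (inLieU h₁ A)) (𝟙 (inClass μ A)) (𝟙 (inLieU h₂ B)) (𝟙 (inClass μ B)))
               (cong (λ x → 𝟙 (inLieU h₁ A) * (𝟙 (inLieU h₂ B) * x)) (class-pair μ A B)))) ⟩
        ∑ allMats (λ A → ∑ allMats (λ B → 𝟙 (inLieU h₁ A) * (𝟙 (inLieU h₂ B) * (𝟙 (inClass μ A) * fixing A B)))) ∎
        where
        Z = centralizerSize μ
        open import Data.Nat.Solver using (module +-*-Solver)
        open +-*-Solver
        rearrange : ∀ z a c b d → z * (a * c) * (b * d) ≡ a * (b * (c * (d * z)))
        rearrange = solve 5 (λ z a c b d → z :* (a :* c) :* (b :* d) := a :* (b :* (c :* (d :* z)))) refl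
      collect : ∀ A B → ∑ P (λ μ → 𝟙 (inLieU h₁ A) * (𝟙 (inLieU h₂ B) * (𝟙 (inClass μ A) * fixing A B))) ≡
                        𝟙 (inLieU h₁ A) * (𝟙 (inLieU h₂ B) * fixing A B)
      collect A B = trans (∑-*ˡ P (𝟙 (inLieU h₁ A)) (λ μ → 𝟙 (inLieU h₂ B) * (𝟙 (inClass μ A) * fixing A B)))
        (𝟙-guard (inLieU-reflects h₁ A) (λ a → trans (∑-*ˡ P (𝟙 (inLieU h₂ B)) (λ μ → 𝟙 (inClass μ A) * fixing A B))
          (cong (𝟙 (inLieU h₂ B) *_) (trans (∑-*ʳ P (fixing A B) (λ μ → 𝟙 (inClass μ A)))
            (trans (cong (_* fixing A B) (one-class {h₁} a)) (*-identityˡ _))))))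

  -- Each order is q^(n² - |h|). By `complement-size` the two exponents and the two sizes add up to
  -- 2n², so the truncated subtraction is exact.
  lieSize-∸ : ∀ h₁ h₂ → lieSize h₁ * lieSize h₂ ≡ q ^ (2 * (n * n) ∸ (size h₁ + size h₂))
  lieSize-∸ h₁ h₂ = begin
    lieSize h₁ * lieSize h₂ ≡⟨ cong₂ _*_ (lieSize≡ h₁) (lieSize≡ h₂) ⟩
    q ^ e₁ * q ^ e₂         ≡⟨ ^-distribˡ-+-* q e₁ e₂ ⟨
    q ^ (e₁ + e₂)           ≡⟨ cong (q ^_) exponent ⟨
    q ^ (2 * (n * n) ∸ (size h₁ + size h₂)) ∎
    where
    open ≡-Reasoning
    open import Algebra.Properties.CommutativeSemigroup +-commutativeSemigroup using (interchange)
    e : Hessenberg n → ℕ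
    e h = ∑ (allFin n) (λ i → n ∸ suc (toℕ (fun h i)))
    e₁ = e h₁
    e₂ = e h₂
    exponent : 2 * (n * n) ∸ (size h₁ + size h₂) ≡ e₁ + e₂
    exponent = trans (cong (_∸ (size h₁ + size h₂)) (trans (cong (n * n +_) (+-identityʳ (n * n)))
      (trans (cong₂ _+_ (sym (complement-size h₁)) (sym (complement-size h₂))) (interchange e₁ (size h₁) e₂ (size h₂)))))
      (m+n∸n≡m (e₁ + e₂) (size h₁ + size h₂))

theorem2p11 : (𝔽 : FiniteField) (n : ℕ) (h₁ h₂ : Hessenberg n) →
    Matrices.doubleCosets 𝔽 n h₁ h₂ * FiniteField.q 𝔽 ^ (2 * (n * n) ∸ (size h₁ + size h₂))
    ≡ sum (map (λ μ → Matrices.centralizerSize 𝔽 n μ * Matrices.Fcount 𝔽 n μ h₁ * Matrices.Fcount 𝔽 n μ h₂)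
    (partitions n))
theorem2p11 𝔽 n h₁ h₂ = trans (cong (Matrices.doubleCosets 𝔽 n h₁ h₂ *_) (sym (lieSize-∸ h₁ h₂)))
  (trans (burnside h₁ h₂) (sym (sum-over-classes h₁ h₂)))
  where open DoubleCosets 𝔽 n
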